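{- Let $G$ be a simple loony endgame with no 3-chains. Let $f$ be the number of 4-loops in $G$ and let $c=cv(G)$. (a) If $c\ge2$ or $G$ is empty then $v(G)=c$. Assume from now on that $G$ is non-empty. (b) If $c\le1$, $f=0$ and $c$ is odd then $v(G)=3$. (c) If $c\le1$, $f=0$ and $c$ is even then $v(G)\in\{2,4\}$ and $v(G)\equiv c\pmod 4$. (d) If $c\le1$ and $f\ge1$, let $K$ denote $G$ with all its 4-loops removed, and let $d$ be the unique integer with $0\le d\le7$ and $d\equiv v(K)\pmod 8$. If $f$ is odd then $v(G)=|4-d|$, and if $f$ is even then $v(G)=4-|4-d|$.
   Context: Game. A dots and boxes game (position) $G$ consists of a finite set of unclaimed boxes and a finite set of undrawn lines, each undrawn line bordering either exactly one box or exactly two distinct boxes, each box being bordered by at least one and at most four undrawn lines. Two players play. The player to move draws (removes) an undrawn line; every box none of whose bordering lines is still undrawn is then claimed by that player. If the move claims at least one box the same player must move again (if a line remains); otherwise the other player moves. Claiming a box when possible is not compulsory. The game ends when no line remains. Each player maximises (own boxes) minus (opponent's boxes), counting only boxes claimed from $G$ onwards. Value. $v(G)$ is the net score, under optimal play, of the player who is NOT to move in $G$. Equivalently, $v(G)=0$ if $G$ has no undrawn lines, and otherwise $v(G)=\min_m v(G;m)$ over undrawn lines $m$, where, if drawing $m$ claims $k$ boxes and leaves the position $G_m$, then $v(G;m)=v(G_m)-k$ if $k\ge1$ and $v(G;m)=-v(G_m)$ if $k=0$. Chains and loops. An $n$-chain has boxes $b_1,\dots,b_n$ and lines $e_0,\dots,e_n$,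 where $e_i$ borders $b_i,b_{i+1}$ for $1\le i\le n-1$, $e_0$ borders only $b_1$ and $e_n$ borders only $b_n$. An $n$-loop ($n\ge4$) has boxes $b_1,\dots,b_n$ and lines $e_1,\dots,e_n$, $e_i$ bordering $b_i,b_{i+1}$ (indices mod $n$). A simple loony endgame is a finite (possibly empty) disjoint union of chains of length at least 3 and loops of even length at least 4. Controlled value. If $G$ is a simple loony endgame with chains of lengths $c_i$ and loops of lengths $\ell_j$, then $fcv(G)=\sum_i(c_i-4)+\sum_j(\ell_j-8)$ and $cv(G)=fcv(G)+tb(G)$, where the terminal bonus $tb(G)$ is: $0$ if $G$ is empty; $4$ if $G$ is non-empty and has a chain of length at least 4 or has no loops; $8$ if $G$ has loops but no chains; $6$ if $G$ has both chains and loops and all its chains are 3-chains. -}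

module Defs where

open import Data.Fin using (Fin)
open import Data.Fin.Subset using (Subset; ⊥; ⁅_⁆; _∪_; _─_; ⋃)
  renaming (_∈_ to _∈ˢ_; ∣_∣ to size)
open import Data.Fin.Subset.Properties using () renaming (_∈?_ to _∈ˢ?_)
open import Data.Integer using (ℤ; +_; -_; _+_; _-_; _⊓_; 0ℤ)
open import Data.Integer.Divisibility using (_∣_)
open import Data.List using (List; []; _∷_; _++_; _∷ʳ_; map; zipWith; filter; foldr; length; concat; concatMap)
open import Data.List.Relation.Binary.Permutation.Propositional using (_↭_; ↭-refl; ↭-sym)
open import Data.List.Relation.Binary.Permutation.Propositional.Properties using (All-resp-↭; filter-↭; ↭-length)
open import Data.List.Relation.Binary.Sublist.Propositional as Sublist using (_⊆_; ⊆-refl)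
open import Data.List.Relation.Binary.Sublist.Propositional.Properties
  using (All-resp-⊆; length-mono-≤; filter-⊆; ++⁺; ++⁺ˡ)
  renaming (filter⁺ to ⊆-filter⁺)
open import Data.List.Relation.Unary.All using (All)
open import Data.List.Relation.Unary.All.Properties using () renaming (filter⁺ to All-filter⁺)
open import Data.List.Relation.Unary.AllPairs using ([]; _∷_)
open import Data.List.Relation.Unary.Any using (any?)
open import Data.List.Relation.Unary.Unique.Propositional using (Unique)
import Data.Nat as ℕ
open import Data.Nat using (ℕ; zero; suc; _≤_; _≤?_)
import Data.Nat.Divisibility as ℕ
open import Data.Nat.Properties using (≤-trans; ≤-reflexive)
open import Data.Product using (_×_)
open import Data.Sum using (_⊎_)
open import Data.Vec using (Vec; lookup; removeAt; toList; fromList)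
import Data.Vec.Functional as Functional
open import Data.Bool using (if_then_else_)
open import Relation.Binary.PropositionalEquality using (_≡_; refl)
open import Relation.Nullary using (¬_; does)
open import Relation.Nullary.Decidable using (¬?)

infix 4 _≡_[mod_]

_≡_[mod_] : ℤ → ℤ → ℕ → Set
i ≡ j [mod n ] = + n ∣ (i - j)

-- A line is the set of boxes it borders.
Line : ℕ → Set
Line n = Subset n

degree : ∀ {n} → Fin n → List (Line n) → ℕ
degree b ls = length (filter (b ∈ˢ?_) ls)

-- The boxes of a game are drawn from a fixed board `Fin boxes`.  The unclaimed
-- boxes are exactly those bordered by at least one undrawn line; any other
-- element of the board is a box already claimed, and plays no further part.
-- Different undrawn lines may border the same boxes, hence a list.
record Game : Set where
  field
    boxes     : ℕ
    lines     : List (Line boxes)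
    line-size : All (λ l → size l ≡ 1 ⊎ size l ≡ 2) lines
    degree≤4  : ∀ b → degree b lines ≤ 4

-- ⋃ of the remaining lines is the set of boxes that stay unclaimed.
claimed : ∀ {n m} → Line n → Vec (Line n) m → ℕ
claimed l rest = size (l ─ ⋃ (toList rest))

-- The value of a move claiming k boxes and leaving a position of value x.
moveValue : (k : ℕ) (x : ℤ) → ℤ
moveValue zero        x = - x
moveValue k@(suc _) x = x - + k

minimum : ∀ {m} → (Fin (suc m) → ℤ) → ℤ
minimum f = Functional.foldr _⊓_ (Functional.head f) (Functional.tail f)

value : ∀ {n m} → Vec (Line n) m → ℤ
value {m = zero}  _  = 0ℤ
value {m = suc _} ls = minimum λ i →
  moveValue (claimed (lookup ls i) (removeAt ls i)) (value (removeAt ls i))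

v : Game → ℤ
v G = value (fromList (Game.lines G))

-- The lines of the chain through the boxes b₁, …, bₙ in this order: eᵢ borders
-- bᵢ and bᵢ₊₁, where the missing boxes b₀ and bₙ₊₁ contribute ⊥.
chainLines : ∀ {n} → List (Fin n) → List (Line n)
chainLines bs = zipWith _∪_ (⊥ ∷ map ⁅_⁆ bs) (map ⁅_⁆ bs ∷ʳ ⊥)

loopLines : ∀ {n} → List (Fin n) → List (Line n)
loopLines []       = []
loopLines (b ∷ bs) = zipWith _∪_ (map ⁅_⁆ (b ∷ bs)) (map ⁅_⁆ (bs ∷ʳ b))

record SimpleLoonyEndgame : Set where
  field
    game : Game

  open Game game public

  -- Each chain and each loop is given by its boxes in order.
  field
    chains       : List (List (Fin boxes))
    loops        : List (List (Fin boxes))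
    chain-length : All (λ bs → 3 ≤ length bs) chains
    loop-length  : All (λ bs → 4 ≤ length bs × 2 ℕ.∣ length bs) loops
    disjoint     : Unique (concat chains ++ concat loops)
    decompose    : lines ↭ concatMap chainLines chains ++ concatMap loopLines loops

  chainLengths loopLengths : List ℕ
  chainLengths = map length chains
  loopLengths  = map length loops

open SimpleLoonyEndgame using (chainLengths; loopLengths)

Empty : SimpleLoonyEndgame → Set
Empty G = chains ≡ [] × loops ≡ []
  where open SimpleLoonyEndgame G using (chains; loops)

No3Chains : SimpleLoonyEndgame → Set
No3Chains G = All (λ c → ¬ (c ≡ 3)) (chainLengths G)

sumℤ : List ℤ → ℤ
sumℤ = foldr _+_ 0ℤ

fcv : SimpleLoonyEndgame → ℤ
fcv G = sumℤ (map (λ c → + c - + 4) (chainLengths G))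
      + sumℤ (map (λ l → + l - + 8) (loopLengths G))

terminalBonus : (chainLens loopLens : List ℕ) → ℤ
terminalBonus []         []      = + 0
terminalBonus []         (_ ∷ _) = + 8
terminalBonus (_ ∷ _)    []      = + 4
terminalBonus cs@(_ ∷ _) (_ ∷ _) = if does (any? (4 ≤?_) cs) then + 4 else + 6

tb : SimpleLoonyEndgame → ℤ
tb G = terminalBonus (chainLengths G) (loopLengths G)

cv : SimpleLoonyEndgame → ℤ
cv G = fcv G + tb G

#4-loops : SimpleLoonyEndgame → ℕ
#4-loops G = length (filter (ℕ._≟ 4) (loopLengths G))

private
  concatMap-⊆ : ∀ {A B : Set} (f : A → List B) {xs ys} →
                xs ⊆ ys → concatMap f xs ⊆ concatMap f ys
  concatMap-⊆ f Sublist.[]               = Sublist.[]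
  concatMap-⊆ f (y Sublist.∷ʳ p)         = ++⁺ˡ (f y) (concatMap-⊆ f p)
  concatMap-⊆ f (Sublist._∷_ {x} refl p) = ++⁺ (⊆-refl {x = f x}) (concatMap-⊆ f p)

  concat-⊆ : ∀ {A : Set} {xss yss : List (List A)} →
             xss ⊆ yss → concat xss ⊆ concat yss
  concat-⊆ Sublist.[]               = Sublist.[]
  concat-⊆ (ys Sublist.∷ʳ p)        = ++⁺ˡ ys (concat-⊆ p)
  concat-⊆ (Sublist._∷_ {x} refl p) = ++⁺ (⊆-refl {x = x}) (concat-⊆ p)

  Unique-⊆ : ∀ {A : Set} {xs ys : List A} → xs ⊆ ys → Unique ys → Unique xs
  Unique-⊆ Sublist.[]           _        = []
  Unique-⊆ (_ Sublist.∷ʳ p)     (_ ∷ us) = Unique-⊆ p us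
  Unique-⊆ (refl Sublist.∷ p)   (u ∷ us) = All-resp-⊆ p u ∷ Unique-⊆ p us

  degree-⊆ : ∀ {n} (b : Fin n) {ls ms} → ls ⊆ ms → degree b ls ≤ degree b ms
  degree-⊆ b p = length-mono-≤ (⊆-filter⁺ (b ∈ˢ?_) (b ∈ˢ?_) (λ { refl q → q }) p)

without4Loops : SimpleLoonyEndgame → SimpleLoonyEndgame
without4Loops G = record
  { game = record
    { boxes     = boxes
    ; lines     = kept
    ; line-size = All-resp-⊆ kept⊆ (All-resp-↭ decompose line-size)
    ; degree≤4  = λ b → ≤-trans (degree-⊆ b kept⊆)
        (≤-trans (≤-reflexive (↭-length (filter-↭ (b ∈ˢ?_) (↭-sym decompose)))) (degree≤4 b))
    }
  ; chains       = chains
  ; loops        = longLoops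
  ; chain-length = chain-length
  ; loop-length  = All-filter⁺ not4? loop-length
  ; disjoint     = Unique-⊆ (++⁺ (⊆-refl {x = concat chains}) (concat-⊆ longLoops⊆)) disjoint
  ; decompose    = ↭-refl
  }
  where
  open SimpleLoonyEndgame G
  not4? = λ (bs : List (Fin boxes)) → ¬? (length bs ℕ.≟ 4)
  longLoops = filter not4? loops
  longLoops⊆ : longLoops ⊆ loops
  longLoops⊆ = filter-⊆ not4? loops
  kept = concatMap chainLines chains ++ concatMap loopLines longLoops
  kept⊆ : kept ⊆ concatMap chainLines chains ++ concatMap loopLines loops
  kept⊆ = ++⁺ (⊆-refl {x = concatMap chainLines chains}) (concatMap-⊆ loopLines longLoops⊆)

{-# OPTIONS --safe #-}

-- Suppose a component of n boxes is opened, and let t be 2 for a chain and 4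
-- for a loop.  The opponent takes all but the last t boxes and then either
-- takes these as well, or gives them away to keep control.  So opening it
-- turns a rest of value x into a position of value n − t + |x − t|.  In
-- general, if the untouched chains and loops have value x and there are T
-- capturable boxes, the value is x − T − 2 (x ∸ t), where t is 2 if a path of
-- at least 2 boxes has exactly one of its two end lines, else 4 if a path of
-- at least 4 boxes has neither; without such a path the value is x − T.
--
-- Without 3-chains, the resulting recursion for x is solved by opening the
-- 4-loops first, then the 6-loops: a 4-loop acts as x ↦ |x − 4|, a 6-loop as
-- x ↦ 2 + |x − 4|, and the remaining components have value cv.  Opening another
-- loop early is no better because both maps are nonexpansive; for a chain, one
-- follows how they change the values with and without it.  The claim describes
-- the orbits of these two maps.
module Submission where

-- The formula with `T` capturable boxes weighs two plans: taking everything and then having to open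
-- nets `T − x`, while handing over the last `t` boxes nets `T − 2t + x`. The better of the two is
-- `T − x + 2 (x ∸ t)`. The players have many other moves, such as ignoring captures, splitting
-- opened paths or cutting a chain in the middle. The formula is therefore stated for every position
-- that cuts can produce, and each single move is checked against it. Because
-- `|x − t| + x = t + 2 (x ∸ t)`, values before and after a move without capture are compared
-- through their sum, in ℕ and without absolute values. Chains of at least 4 and loops of at least 8
-- boxes contribute nothing negative to `fcv`, so only 4- and 6-loops can pull a value down into the
-- region where `|x − 4|` reflects. All loops act through this one map up to an added constant, so
-- exchanging two of them disturbs only constants. A chain acts through `|x − 2|`, which does not
-- commute with it; this is why the chain needs the explicit relations between pairs of values.

module Values where

  open import Data.Integer as ℤ using (ℤ; +_; _⊖_) renaming (_≤_ to _≤ᶻ_)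
  import Data.Integer.Divisibility as ℤ
  import Data.Integer.Properties as ℤ
  open import Data.Nat
  open import Data.Nat.Divisibility as ℕ using (divides)
  open import Data.Nat.GeneralisedArithmetic using (fold)
  open import Data.Nat.Properties
  open import Data.Nat.Tactic.RingSolver using (solve-∀)
  open import Data.Product using (∃; ∃₂; _×_; _,_; proj₁; proj₂)
  open import Data.Sum using (_⊎_; inj₁; inj₂)
  open import Defs using (_≡_[mod_])
  open import Relation.Binary.PropositionalEquality
  open import Relation.Nullary using (¬_; contradiction)

  -- The maps by which loops act on values, and the closed formula.

  -- Defined by patterns instead of as a distance, so that `open4 (4 + v)` reduces to `v` for a
  -- variable `v`.
  open4 : ℕ → ℕ
  open4 (suc (suc (suc (suc v)))) = v
  open4 v = 4 ∸ v

  open6 : ℕ → ℕ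
  open6 v = 2 + open4 v

  open4-∣-∣ : ∀ v → open4 v ≡ ∣ v - 4 ∣
  open4-∣-∣ 0 = refl
  open4-∣-∣ 1 = refl
  open4-∣-∣ 2 = refl
  open4-∣-∣ 3 = refl
  open4-∣-∣ (suc (suc (suc (suc v)))) = sym (∣-∣-identityʳ v)

  -- Trades the absolute value for a truncated difference; `penalty` has the same shape, so the two
  -- sides of a move become comparable.
  open4-+ : ∀ v → open4 v + v ≡ 4 + 2 * (v ∸ 4)
  open4-+ 0 = refl
  open4-+ 1 = refl
  open4-+ 2 = refl
  open4-+ 3 = refl
  open4-+ (suc (suc (suc (suc v)))) = lemma v
    where
    lemma : ∀ v → v + (4 + v) ≡ 4 + 2 * v
    lemma = solve-∀

  private
    dist≤ : ∀ {a b k} → a ≤ k + b → b ≤ k + a → ∣ a - b ∣ ≤ k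
    dist≤ {a} {b} {k} p q with ∣m-n∣≡[m∸n]∨[n∸m] a b
    ... | inj₂ eq = subst (_≤ k) (sym eq) (m≤n+o⇒m∸n≤o b a (subst (b ≤_) (+-comm k a) q))
    ... | inj₁ eq = subst (_≤ k) (sym eq) (m≤n+o⇒m∸n≤o a b (subst (a ≤_) (+-comm k b) p))

  Nonexpansive : (ℕ → ℕ) → Set
  Nonexpansive φ = ∀ x y → ∣ φ x - φ y ∣ ≤ ∣ x - y ∣

  open4-nonexpansive : Nonexpansive open4
  open4-nonexpansive x y rewrite open4-∣-∣ x | open4-∣-∣ y =
    dist≤ (∣-∣-triangle x y 4)
          (subst (λ d → _ ≤ d + ∣ x - 4 ∣) (∣-∣-comm y x) (∣-∣-triangle y x 4))

  fold-nonexpansive : ∀ {φ} → Nonexpansive φ → ∀ n → Nonexpansive (λ x → fold x φ n)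
  fold-nonexpansive φ-ne zero    x y = ≤-refl
  fold-nonexpansive φ-ne (suc n) x y = ≤-trans (φ-ne _ _) (fold-nonexpansive φ-ne n x y)

  fold-shift : ∀ (φ : ℕ → ℕ) z n → fold (φ z) φ n ≡ φ (fold z φ n)
  fold-shift φ z zero    = refl
  fold-shift φ z (suc n) = cong φ (fold-shift φ z n)

  -- The value of f 4-loops and m 6-loops together with a position of value w:
  -- the 4-loops are opened first, then the 6-loops.
  short : (f m w : ℕ) → ℕ
  short f m w = fold (fold w open6 m) open4 f

  -- `short f m` is a composite of nonexpansive maps, so a gap of `k` at the start is at most `k` at
  -- the end.
  short-shift : ∀ f m k w → short f m (k + w) ≤ k + short f m w
  short-shift f m k w = begin
    x                ≤⟨ m≤∣m-n∣+n x y ⟩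
    ∣ x - y ∣ + y    ≤⟨ +-monoˡ-≤ y (≤-trans (fold-nonexpansive open4-nonexpansive f _ _)
                          (fold-nonexpansive open4-nonexpansive m _ _)) ⟩
    ∣ k + w - w ∣ + y ≡⟨ cong (_+ y) (∣m+n-n∣ k w) ⟩
    k + y            ∎
    where
    open ≤-Reasoning
    x = short f m (k + w)
    y = short f m w
    ∣m+n-n∣ : ∀ k w → ∣ k + w - w ∣ ≡ k
    ∣m+n-n∣ k w = trans (cong (λ u → ∣ u - w ∣) (+-comm k w)) (trans (∣-∣-comm (w + k) w) (∣m-m+n∣≡n w k))

  -- The right side opens the new 6-loop while the other short loops still wait. `open4` commutes
  -- with its own iterates, so only the constant 2 of `open6` has to pass the 4-loops, and they do
  -- not enlarge it.
  short-6loop : ∀ f m w → short f (suc m) w ≤ open6 (short f m w)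
  short-6loop f m w = subst (λ z → short f (suc m) w ≤ 2 + z) (fold-shift open4 (fold w open6 m) f)
    (short-shift f 0 2 (open4 (fold w open6 m)))

  -- A loop of length 8 + k turns w into 4 + k + open4 w.
  short-loop : ∀ f m k w → short f m (4 + k + open4 w) ≤ 4 + k + open4 (short f m w)
  short-loop f m k w = begin
    short f m (4 + k + open4 w)           ≡⟨ cong (short f m) (lemma k (open4 w)) ⟩
    short f m (2 + k + open6 w)           ≤⟨ short-shift f m (2 + k) (open6 w) ⟩
    2 + k + short f m (open6 w)           ≡⟨ cong (λ u → 2 + k + fold u open4 f) (fold-shift open6 w m) ⟩
    2 + k + short f (suc m) w             ≤⟨ +-monoʳ-≤ (2 + k) (short-6loop f m w) ⟩
    2 + k + open6 (short f m w)           ≡⟨ sym (lemma k _) ⟩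
    4 + k + open4 (short f m w)           ∎
    where
    open ≤-Reasoning
    lemma : ∀ k a → 4 + k + a ≡ 2 + k + (2 + a)
    lemma = solve-∀

  -- The pairs into which the short loops can turn the values 4 + s, and
  -- long nc nb s, with and without a chain; `Related4` includes the 4-loops.
  data Related6 : (p q : ℕ) → Set where
    same  : ∀ {p} → Related6 p p
    shift : ∀ {p} → Related6 (2 + p) (6 + p)
    r35   : Related6 3 5
    r40   : Related6 4 0

  data Related4 : (p q : ℕ) → Set where
    same    : ∀ {p} → Related4 p p
    shift   : ∀ {p} → Related4 p (4 + p)
    r35     : Related4 3 5
    reflect : ∀ {p} → p ≤ 4 → Related4 p (4 ∸ p)

  -- A gap of four persists while the smaller entry is at least 4. From 2 and 6 both entries become
  -- 4; from 3 and 7 they become 3 and 5, and then 3 and 3. The pair of 4 and 0 turns into 2 and 6.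
  open6-related : ∀ {p q} → Related6 p q → Related6 (open6 p) (open6 q)
  open6-related same      = same
  open6-related (shift {zero})        = same
  open6-related (shift {suc zero})    = r35
  open6-related (shift {suc (suc p)}) = shift
  open6-related r35       = same
  open6-related r40       = shift

  -- A gap of four persists while the smaller entry is at least 4. Below that the pair becomes two
  -- numbers with sum 4, which further steps only exchange. The entries 3 and 5 meet at 1.
  open4-related : ∀ {p q} → Related4 p q → Related4 (open4 p) (open4 q)
  open4-related same = same
  open4-related (shift {0}) = reflect ≤-refl
  open4-related (shift {1}) = reflect (m≤m+n 3 1)
  open4-related (shift {2}) = reflect (m≤m+n 2 2)
  open4-related (shift {3}) = reflect (m≤m+n 1 3)
  open4-related (shift {suc (suc (suc (suc p)))}) = shift
  open4-related r35 = same
  open4-related (reflect {0} _) = reflect ≤-refl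
  open4-related (reflect {1} _) = reflect (m≤m+n 3 1)
  open4-related (reflect {2} _) = reflect (m≤m+n 2 2)
  open4-related (reflect {3} _) = reflect (m≤m+n 1 3)
  open4-related (reflect {4} _) = reflect z≤n
  open4-related (reflect {suc (suc (suc (suc (suc _))))} (s≤s (s≤s (s≤s (s≤s ())))))

  weaken : ∀ {p q} → Related6 p q → Related4 p q
  weaken same  = same
  weaken shift = shift
  weaken r35   = r35
  weaken r40   = reflect ≤-refl

  short-related : ∀ f m {p q} → Related6 p q → Related4 (short f m p) (short f m q)
  short-related zero    zero    r = weaken r
  short-related zero    (suc m) r = weaken (go (suc m) r)
    where
    go : ∀ m {p q} → Related6 p q → Related6 (fold p open6 m) (fold q open6 m)
    go zero    r = r
    go (suc m) r = open6-related (go m r)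
  short-related (suc f) m       r = open4-related (short-related f m r)

  -- Subtraction-free form of `p ≤ 2 + |q − 2|`, where the right side is the value of opening a
  -- 4-chain whose rest has value `q`.
  related-bound : ∀ {p q} → Related4 p q → p + q ≤ 4 + 2 * (q ∸ 2)
  related-bound (same {0}) = z≤n
  related-bound (same {1}) = m≤m+n 2 2
  related-bound (same {suc (suc p)}) = ≤-reflexive (lemma p)
    where
    lemma : ∀ p → 2 + p + (2 + p) ≡ 4 + 2 * p
    lemma = solve-∀
  related-bound (shift {p}) = subst (p + (4 + p) ≤_) (lemma p) (m≤m+n _ 4)
    where
    lemma : ∀ p → p + (4 + p) + 4 ≡ 4 + 2 * (2 + p)
    lemma = solve-∀
  related-bound r35 = m≤m+n 8 2
  related-bound (reflect {p} p≤4) = ≤-trans (≤-reflexive (m+[n∸m]≡n p≤4)) (m≤m+n 4 _)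

  -- The value of nc chains and nb loops longer than 6, of total controlled
  -- value s before the terminal bonus.
  long : (nc nb s : ℕ) → ℕ
  long zero    zero    _ = 0
  long zero    (suc _) s = 8 + s
  long (suc _) _       s = 4 + s

  -- A loop opened with nothing left is worth its full length, as `open4 0` is 4; this is the source
  -- of the bonus 8. Otherwise the rest is at least 4 and `open4` just subtracts. The premise says
  -- that excess can only come from chains and long loops.
  long-loop : ∀ nc nb k s → (nc ≡ 0 → nb ≡ 0 → s ≡ 0) →
              long nc (suc nb) (k + s) ≡ 4 + k + open4 (long nc nb s)
  long-loop zero    zero    k s z rewrite z refl refl = lemma k
    where
    lemma : ∀ k → 8 + (k + 0) ≡ 4 + k + 4
    lemma = solve-∀
  long-loop zero    (suc _) k s z = lemma k s
    where
    lemma : ∀ k s → 8 + (k + s) ≡ 4 + k + (4 + s)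
    lemma = solve-∀
  long-loop (suc _) nb      k s z = refl

  -- Only the bonus changes when a chain is added: it is new if nothing was there (`r40`), drops
  -- from 8 to 4 if there were only loops (`shift`), and stays 4 if there was a chain.
  long-chain : ∀ nc nb s → (nc ≡ 0 → nb ≡ 0 → s ≡ 0) → Related6 (4 + s) (long nc nb s)
  long-chain zero    zero    s z rewrite z refl refl = r40
  long-chain zero    (suc _) s z = shift
  long-chain (suc _) nb      s z = same

  opaque
    -- Opaque, so that goals about positions retain the five counts and do not unfold into iterates.
    closed : (f m nc nb s : ℕ) → ℕ
    closed f m nc nb s = short f m (long nc nb s)

    closed-def : ∀ f m nc nb s → closed f m nc nb s ≡ short f m (long nc nb s)
    closed-def f m nc nb s = refl

    closed-empty : ∀ s → closed 0 0 0 0 s ≡ 0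
    closed-empty s = refl

  -- Opening any component of a closed position: bounds and equality cases.

  module _ (f m nc nb s : ℕ) (z : nc ≡ 0 → nb ≡ 0 → s ≡ 0) where

    private
      v = closed f m nc nb s

      bound : ∀ {x} k → x ≤ k + open4 v → x + v ≤ 4 + k + 2 * (v ∸ 4)
      bound {x} k x≤ = begin
        x + v                   ≤⟨ +-monoˡ-≤ v x≤ ⟩
        k + open4 v + v         ≡⟨ +-assoc k (open4 v) v ⟩
        k + (open4 v + v)       ≡⟨ cong (_+_ k) (open4-+ v) ⟩
        k + (4 + 2 * (v ∸ 4))   ≡⟨ lemma k (2 * (v ∸ 4)) ⟩
        4 + k + 2 * (v ∸ 4)     ∎
        where
        open ≤-Reasoning
        lemma : ∀ k a → k + (4 + a) ≡ 4 + k + a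
        lemma = solve-∀

    opaque
      unfolding closed

      closed-4loop : closed (suc f) m nc nb s + v ≤ 4 + 2 * (v ∸ 4)
      closed-4loop = bound 0 ≤-refl

      closed-6loop : closed f (suc m) nc nb s + v ≤ 6 + 2 * (v ∸ 4)
      closed-6loop = bound 2 (short-6loop f m (long nc nb s))

      closed-loop : ∀ k → closed f m nc (suc nb) (k + s) + v ≤ 8 + k + 2 * (v ∸ 4)
      closed-loop k = bound (4 + k) (≤-trans (≤-reflexive (cong (short f m) (long-loop nc nb k s z)))
        (short-loop f m k (long nc nb s)))

      -- The length beyond 4 passes through the short loops by `short-shift`. What remains is a
      -- 4-chain, where the values with and without it form a related pair.
      closed-chain : ∀ k → closed f m (suc nc) nb (k + s) + v ≤ 4 + k + 2 * (v ∸ 2)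
      closed-chain k = begin
        short f m (4 + (k + s)) + v       ≡⟨ cong (λ u → short f m u + v) (lemma k s) ⟩
        short f m (k + (4 + s)) + v       ≤⟨ +-monoˡ-≤ v (short-shift f m k (4 + s)) ⟩
        k + short f m (4 + s) + v         ≡⟨ +-assoc k _ v ⟩
        k + (short f m (4 + s) + v)       ≤⟨ +-monoʳ-≤ k (related-bound (short-related f m (long-chain nc nb s z))) ⟩
        k + (4 + 2 * (v ∸ 2))             ≡⟨ lemma′ k (2 * (v ∸ 2)) ⟩
        4 + k + 2 * (v ∸ 2)               ∎
        where
        open ≤-Reasoning
        lemma : ∀ k s → 4 + (k + s) ≡ k + (4 + s)
        lemma = solve-∀
        lemma′ : ∀ k a → k + (4 + a) ≡ 4 + k + a
        lemma′ = solve-∀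

  -- Equality holds for a 4-loop if there is one, else for a 6-loop, else for a
  -- long loop, else for a chain.
  opaque
    unfolding closed

    closed-4loop-tight : ∀ f m nc nb s → let v = closed f m nc nb s in
                         4 + 2 * (v ∸ 4) ≤ closed (suc f) m nc nb s + v
    closed-4loop-tight f m nc nb s = ≤-reflexive (sym (open4-+ (closed f m nc nb s)))

    closed-6loop-tight : ∀ m nc nb s → let v = closed 0 m nc nb s in
                         6 + 2 * (v ∸ 4) ≤ closed 0 (suc m) nc nb s + v
    closed-6loop-tight m nc nb s = ≤-reflexive (cong (_+_ 2) (sym (open4-+ (closed 0 m nc nb s))))

    closed-loop-tight : ∀ nc nb s → (nc ≡ 0 → nb ≡ 0 → s ≡ 0) → ∀ k → let v = closed 0 0 nc nb s in
                        8 + k + 2 * (v ∸ 4) ≤ closed 0 0 nc (suc nb) (k + s) + v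
    closed-loop-tight nc nb s z k = ≤-reflexive (sym (begin
      long nc (suc nb) (k + s) + v  ≡⟨ cong (_+ v) (long-loop nc nb k s z) ⟩
      4 + k + open4 v + v           ≡⟨ +-assoc (4 + k) _ v ⟩
      4 + k + (open4 v + v)         ≡⟨ cong (_+_ (4 + k)) (open4-+ v) ⟩
      4 + k + (4 + 2 * (v ∸ 4))     ≡⟨ lemma k _ ⟩
      8 + k + 2 * (v ∸ 4)           ∎))
      where
      open ≡-Reasoning
      v : ℕ
      v = long nc nb s
      lemma : ∀ k a → 4 + k + (4 + a) ≡ 8 + k + a
      lemma = solve-∀

    closed-chain-tight : ∀ nc s → (nc ≡ 0 → s ≡ 0) → ∀ k → let v = closed 0 0 nc 0 s in
                         4 + k + 2 * (v ∸ 2) ≤ closed 0 0 (suc nc) 0 (k + s) + v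
    closed-chain-tight zero s z k rewrite z refl = ≤-reflexive (lemma k)
      where
      lemma : ∀ k → 4 + k + 0 ≡ 4 + (k + 0) + 0
      lemma = solve-∀
    closed-chain-tight (suc nc) s z k = ≤-reflexive (lemma k s)
      where
      lemma : ∀ k s → 4 + k + 2 * (2 + s) ≡ 4 + (k + s) + (4 + s)
      lemma = solve-∀

  -- Without 3-chains the terminal bonus of a non-empty endgame depends only on whether there is a
  -- chain.
  bonus : ℕ → ℕ
  bonus zero    = 8
  bonus (suc _) = 4

  -- Opening a first loop of length 4 or 6 has the same value at 0 as at 8.
  short-start : ∀ f m nc nb s → (nc ≡ 0 → nb ≡ 0 → s ≡ 0) → 1 ≤ f + (m + (nc + nb)) →
                short f m (long nc nb s) ≡ short f m (bonus nc + s)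
  short-start f       m       (suc nc) nb       s z 1≤ = refl
  short-start f       m       zero     (suc nb) s z 1≤ = refl
  short-start f       (suc m) zero     zero     s z 1≤ rewrite z refl refl =
    cong (λ w → fold w open4 f) (trans (sym (fold-shift open6 0 m)) (fold-shift open6 8 m))
  short-start (suc f) zero    zero     zero     s z 1≤ rewrite z refl refl =
    trans (sym (fold-shift open4 0 f)) (fold-shift open4 8 f)

  -- The values of positions without 4-loops, by their controlled value: once
  -- the latter is at most 3, a further 6-loop keeps the value 3 and swaps 2 and 4.
  data Phase : ℕ → ℤ → Set where
    exact : ∀ k → Phase (2 + k) (+ (2 + k))
    odd   : ∀ j → Phase 3 (1 ⊖ (2 * j))
    four  : ∀ j → Phase 4 (0 ⊖ (4 * j))
    two   : ∀ j → Phase 2 (0 ⊖ (2 + 4 * j))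

  private
    ⊖-minus2 : ∀ a b → (a ⊖ b) ℤ.+ ℤ.- (+ 2) ≡ a ⊖ (2 + b)
    ⊖-minus2 a b = trans (ℤ.distribˡ-⊖-+-neg 1 a b) (cong (a ⊖_) (+-comm (suc b) 1))

  phase-step : ∀ {v z} → Phase v z → Phase (open6 v) (z ℤ.+ ℤ.- (+ 2))
  phase-step (exact 0)             = four 0
  phase-step (exact 1)             = odd 0
  phase-step (exact (suc (suc k))) = exact k
  phase-step (odd j)  = subst (Phase 3) (trans (cong (1 ⊖_) (lemma j)) (sym (⊖-minus2 1 (2 * j)))) (odd (suc j))
    where
    lemma : ∀ j → 2 * suc j ≡ 2 + 2 * j
    lemma = solve-∀
  phase-step (four j) = subst (Phase 2) (sym (⊖-minus2 0 (4 * j))) (two j)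
  phase-step (two j)  = subst (Phase 4) (trans (cong (0 ⊖_) (lemma j)) (sym (⊖-minus2 0 (2 + 4 * j)))) (four (suc j))
    where
    lemma : ∀ j → 4 * suc j ≡ 2 + (2 + 4 * j)
    lemma = solve-∀

  phase : ∀ w m → 2 ≤ w → Phase (fold w open6 m) (w ⊖ (2 * m))
  phase (suc (suc k)) zero    _  = exact k
  phase (suc zero)    zero    (s≤s ())
  phase w             (suc m) 2≤ = subst (Phase _) (trans (⊖-minus2 w (2 * m)) (cong (w ⊖_) (lemma m))) (phase-step (phase w m 2≤))
    where
    lemma : ∀ m → 2 + 2 * m ≡ 2 * suc m
    lemma = solve-∀

  phase-odd : ∀ {v z} → Phase v z → z ≤ᶻ + 1 → ¬ (+ 2 ℤ.∣ z) → v ≡ 3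
  phase-odd (exact k) (ℤ.+≤+ (s≤s ())) _
  phase-odd (odd j)  _ _ = refl
  phase-odd (four j) _ ¬2∣ = contradiction (divides (2 * j) (trans (ℤ.∣⊖∣-≤ z≤n) (lemma j))) ¬2∣
    where
    lemma : ∀ j → 4 * j ≡ 2 * j * 2
    lemma = solve-∀
  phase-odd (two j)  _ ¬2∣ = contradiction (divides (1 + 2 * j) (trans (ℤ.∣⊖∣-≤ z≤n) (lemma j))) ¬2∣
    where
    lemma : ∀ j → 2 + 4 * j ≡ (1 + 2 * j) * 2
    lemma = solve-∀

  private
    2*≢1+2* : ∀ a b → ¬ (a * 2 ≡ suc (b * 2))
    2*≢1+2* (suc a) (suc b) eq = 2*≢1+2* a b (suc-injective (suc-injective eq))
    2*≢1+2* (suc a) zero ()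

    four-minus : ∀ v n → (+ v) ℤ.+ ℤ.- (0 ⊖ n) ≡ + (v + n)
    four-minus v n = cong (ℤ._+_ (+ v)) (sym (ℤ.⊖-swap n 0))

  phase-even : ∀ {v z} → Phase v z → z ≤ᶻ + 1 → + 2 ℤ.∣ z →
               (+ v ≡ + 2 ⊎ + v ≡ + 4) × (+ v ≡ z [mod 4 ])
  phase-even (exact k) (ℤ.+≤+ (s≤s ())) _
  phase-even (odd zero)    _ (divides q eq) = contradiction (sym eq) (2*≢1+2* q 0)
  phase-even (odd (suc j)) _ (divides q eq) =
    contradiction (trans (sym eq) (trans (ℤ.∣⊖∣-≤ (s≤s z≤n)) (lemma j))) (2*≢1+2* q j)
    where
    lemma : ∀ j → j + suc (j + 0) ≡ suc (j * 2)
    lemma = solve-∀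
  phase-even (four j) _ _ = inj₂ refl , divides (suc j) (trans (cong ℤ.∣_∣ (four-minus 4 (4 * j))) (lemma j))
    where
    lemma : ∀ j → 4 + 4 * j ≡ suc j * 4
    lemma = solve-∀
  phase-even (two j)  _ _ = inj₁ refl , divides (suc j) (trans (cong ℤ.∣_∣ (four-minus 2 (2 + 4 * j))) (lemma j))
    where
    lemma : ∀ j → 2 + (2 + 4 * j) ≡ suc j * 4
    lemma = solve-∀

  -- Since the final value is at least 2, every application starts from at least 4, where `open6`
  -- subtracts exactly 2.
  fold-open6-exact : ∀ m {u} → 2 ≤ u → fold (2 * m + u) open6 m ≡ u
  fold-open6-exact zero    2≤u = refl
  fold-open6-exact (suc m) {u} 2≤u = begin
    open6 (fold (2 * suc m + u) open6 m)      ≡⟨ fold-shift open6 _ m ⟨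
    fold (open6 (2 * suc m + u)) open6 m      ≡⟨ cong (λ w → fold w open6 m) step ⟩
    fold (2 * m + u) open6 m                  ≡⟨ fold-open6-exact m 2≤u ⟩
    u                                         ∎
    where
    open ≡-Reasoning
    open6-+2 : ∀ {x} → 2 ≤ x → open6 (2 + x) ≡ x
    open6-+2 (s≤s (s≤s _)) = refl
    lemma : ∀ m u → 2 * suc m + u ≡ 2 + (2 * m + u)
    lemma = solve-∀
    step : open6 (2 * suc m + u) ≡ 2 * m + u
    step = trans (cong open6 (lemma m u)) (open6-+2 (≤-trans 2≤u (m≤n+m u (2 * m))))

  fold-open4-exact : ∀ f u → fold (4 * f + u) open4 f ≡ u
  fold-open4-exact zero    u = refl
  fold-open4-exact (suc f) u = trans (sym (fold-shift open4 _ f))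
    (trans (cong (λ w → fold w open4 f) (cong open4 (lemma f u))) (fold-open4-exact f u))
    where
    lemma : ∀ f u → 4 * suc f + u ≡ 4 + (4 * f + u)
    lemma = solve-∀

  private
    2≤⊖ : ∀ a b → + 2 ≤ᶻ a ⊖ b → ∃ λ k → a ≡ b + (2 + k) × a ⊖ b ≡ + (2 + k)
    2≤⊖ a b le with ≤-total b a
    ... | inj₁ b≤a with a ∸ b in eq | subst (+ 2 ≤ᶻ_) (ℤ.⊖-≥ b≤a) le
    ... | suc (suc k) | _ = k , trans (sym (m+[n∸m]≡n b≤a)) (cong (_+_ b) eq) , trans (ℤ.⊖-≥ b≤a) (cong +_ eq)
    2≤⊖ a b le | inj₁ b≤a | suc zero | ℤ.+≤+ (s≤s ())
    2≤⊖ a b le | inj₁ b≤a | zero | ℤ.+≤+ ()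
    2≤⊖ a b le | inj₂ a≤b with b ∸ a | subst (+ 2 ≤ᶻ_) (ℤ.⊖-≤ a≤b) le
    ... | zero | ℤ.+≤+ ()
    ... | suc _ | ()

    ⊖≤1 : ∀ a b → a ⊖ b ≤ᶻ + 1 → a ≤ 1 + b
    ⊖≤1 a b le with ≤-total b a
    ... | inj₂ a≤b = m≤n⇒m≤1+n a≤b
    ... | inj₁ b≤a = ≤-trans (≤-reflexive (sym (m∸n+n≡m b≤a))) (+-monoˡ-≤ b (ℤ.drop‿+≤+ (subst (_≤ᶻ + 1) (ℤ.⊖-≥ b≤a) le)))

  short-exact : ∀ f m w → + 2 ≤ᶻ w ⊖ (2 * m + 4 * f) → + short f m w ≡ w ⊖ (2 * m + 4 * f)
  short-exact f m w le with k , w≡ , c≡ ← 2≤⊖ w (2 * m + 4 * f) le = trans (cong +_ (begin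
    short f m w                                        ≡⟨ cong (short f m) (trans w≡ (+-assoc (2 * m) (4 * f) _)) ⟩
    short f m (2 * m + (4 * f + (2 + k)))              ≡⟨ cong (λ u → fold u open4 f) (fold-open6-exact m (≤-trans (m≤m+n 2 k) (m≤n+m _ (4 * f)))) ⟩
    fold (4 * f + (2 + k)) open4 f                     ≡⟨ fold-open4-exact f (2 + k) ⟩
    2 + k                                              ∎)) (sym c≡)
    where open ≡-Reasoning

  -- In the exact phase `v` is `w − 2m`, and a controlled value of at most 1 is the bound itself; in
  -- the other phases `v` is at most 4, so one 4-loop suffices. The bound provides the 4-loops that
  -- bring `v` down to its residue modulo 8, two for each 8.
  phase-bound : ∀ {w m f v} → 1 ≤ f → Phase v (w ⊖ (2 * m)) → w ⊖ (2 * m + 4 * f) ≤ᶻ + 1 → v ≤ 1 + 4 * f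
  phase-bound {w} {m} {f} {v} 1≤f p c≤1 = go p refl
    where
    4≤ : 4 ≤ 1 + 4 * f
    4≤ = m≤n⇒m≤1+n (*-monoʳ-≤ 4 1≤f)
    go : ∀ {v z} → Phase v z → z ≡ w ⊖ (2 * m) → v ≤ 1 + 4 * f
    go (odd j)   _ = ≤-trans (m≤m+n 3 1) 4≤
    go (four j)  _ = 4≤
    go (two j)   _ = ≤-trans (m≤m+n 2 2) 4≤
    go (exact k) eq with k′ , w≡ , eq′ ← 2≤⊖ w (2 * m) (subst (+ 2 ≤ᶻ_) eq (ℤ.+≤+ (m≤m+n 2 k)))
      with refl ← suc-injective (suc-injective (ℤ.+-injective (trans eq eq′))) =
      +-cancelˡ-≤ (2 * m) _ _ (begin
        2 * m + (2 + k)            ≡⟨ sym w≡ ⟩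
        w                          ≤⟨ ⊖≤1 w (2 * m + 4 * f) c≤1 ⟩
        1 + (2 * m + 4 * f)        ≡⟨ sym (+-suc (2 * m) (4 * f)) ⟩
        2 * m + (1 + 4 * f)        ∎)
      where open ≤-Reasoning

  -- Iterating `open4`: dependence on the residue modulo 8 and on parity.

  open4≤4 : ∀ {e} → e ≤ 7 → open4 e ≤ 4
  open4≤4 {0} _ = ≤-refl
  open4≤4 {1} _ = m≤m+n 3 1
  open4≤4 {2} _ = m≤m+n 2 2
  open4≤4 {3} _ = m≤m+n 1 3
  open4≤4 {suc (suc (suc (suc e)))} (s≤s (s≤s (s≤s (s≤s e≤3)))) = m≤n⇒m≤1+n e≤3

  open4-∸ : ∀ {a} → a ≤ 4 → open4 a ≡ 4 ∸ a
  open4-∸ {0} _ = refl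
  open4-∸ {1} _ = refl
  open4-∸ {2} _ = refl
  open4-∸ {3} _ = refl
  open4-∸ {4} _ = refl
  open4-∸ {suc (suc (suc (suc (suc _))))} (s≤s (s≤s (s≤s (s≤s ()))))

  -- One step leads to a value of at most 4. There `open4` is the reflection `a ↦ 4 − a`, an
  -- involution, so only the parity of the number of further steps matters.
  fold-open4-odd : ∀ q {e} → e ≤ 7 → fold e open4 (suc (q * 2)) ≡ open4 e
  fold-open4-odd zero    e≤7 = refl
  fold-open4-odd (suc q) {e} e≤7 rewrite fold-open4-odd q e≤7 | open4-∸ (open4≤4 e≤7) =
    trans (open4-∸ (m∸n≤m 4 (open4 e))) (m∸[m∸n]≡n (open4≤4 e≤7))

  fold-open4-even : ∀ q {e} → e ≤ 7 → fold e open4 (suc q * 2) ≡ 4 ∸ open4 e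
  fold-open4-even q e≤7 = trans (cong open4 (fold-open4-odd q e≤7)) (open4-∸ (open4≤4 e≤7))

  -- Two 4-loops absorb 8 and leave the parity of their number unchanged; hence the answer depends
  -- on the start only modulo 8.
  fold-open4-+8 : ∀ f x → fold (8 + x) open4 (2 + f) ≡ fold x open4 f
  fold-open4-+8 f x = trans (sym (fold-shift open4 (8 + x) (suc f))) (sym (fold-shift open4 (4 + x) f))

  private
    peel : ∀ e k f → e + suc k * 8 ≤ 1 + 4 * (2 + f) → e + k * 8 ≤ 1 + 4 * f
    peel e k f le = +-cancelˡ-≤ 8 _ _ (subst₂ _≤_ (lemma₁ e k) (lemma₂ f) le)
      where
      lemma₁ : ∀ e k → e + suc k * 8 ≡ 8 + (e + k * 8)
      lemma₁ = solve-∀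
      lemma₂ : ∀ f → 1 + 4 * (2 + f) ≡ 8 + (1 + 4 * f)
      lemma₂ = solve-∀

    rotate8 : ∀ e k → e + suc k * 8 ≡ 8 + (e + k * 8)
    rotate8 = solve-∀

  reflect-odd : ∀ q k {e} → e ≤ 7 → e + k * 8 ≤ 1 + 4 * (1 + q * 2) → fold (e + k * 8) open4 (1 + q * 2) ≡ open4 e
  reflect-odd q       zero    {e} e≤7 _  rewrite +-identityʳ e = fold-open4-odd q e≤7
  reflect-odd zero    (suc k) {e} e≤7 le = contradiction (≤-trans (≤-trans (m≤m+n 8 (k * 8)) (m≤n+m _ e)) le) λ { (s≤s (s≤s (s≤s (s≤s (s≤s ()))))) }
  reflect-odd (suc q) (suc k) {e} e≤7 le = trans (cong (λ x → fold x open4 (3 + q * 2)) (rotate8 e k))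
    (trans (fold-open4-+8 (1 + q * 2) (e + k * 8)) (reflect-odd q k e≤7 (peel e k (1 + q * 2) le)))

  reflect-even : ∀ q k {e} → e ≤ 7 → e + k * 8 ≤ 1 + 4 * (q * 2) → fold (e + k * 8) open4 (q * 2) ≡ 4 ∸ open4 e
  -- With no 4-loop left the bound admits only 0 and 1, and there `4 ∸ open4 e` is `e` without any
  -- reflection.
  reflect-even zero    zero    {0} e≤7 le = refl
  reflect-even zero    zero    {1} e≤7 le = refl
  reflect-even zero    zero    {suc (suc _)} e≤7 (s≤s ())
  reflect-even zero    (suc k) {e} e≤7 le = contradiction (≤-trans (≤-trans (m≤m+n 8 (k * 8)) (m≤n+m _ e)) le) λ { (s≤s ()) }
  reflect-even (suc q) zero    {e} e≤7 le rewrite +-identityʳ e = fold-open4-even q e≤7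
  reflect-even (suc q) (suc k) {e} e≤7 le = trans (cong (λ x → fold x open4 (2 + q * 2)) (rotate8 e k))
    (trans (fold-open4-+8 (q * 2) (e + k * 8)) (reflect-even q k e≤7 (peel e k (q * 2) le)))

  half-odd : ∀ f → ¬ (2 ℕ.∣ f) → ∃ λ q → f ≡ 1 + q * 2
  half-odd zero          ¬2∣ = contradiction (divides 0 refl) ¬2∣
  half-odd (suc zero)    ¬2∣ = 0 , refl
  half-odd (suc (suc f)) ¬2∣ with q , refl ← half-odd f (λ { (divides q eq) → ¬2∣ (divides (suc q) (cong (_+_ 2) eq)) }) = suc q , refl

  residue : ∀ {x} (d : ℤ) → + 0 ≤ᶻ d → d ≤ᶻ + 7 → d ≡ + x [mod 8 ] → ∃₂ λ e k → d ≡ + e × e ≤ 7 × x ≡ e + k * 8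
  residue {x} (+ e) _ (ℤ.+≤+ e≤7) (divides k eq) with ≤-total e x
  ... | inj₁ e≤x = e , k , refl , e≤7 , trans (sym (m+[n∸m]≡n e≤x)) (cong (_+_ e)
    (trans (sym (ℤ.∣⊖∣-≤ e≤x)) (trans (cong ℤ.∣_∣ (sym (ℤ.m-n≡m⊖n e x))) eq)))
  -- Divisibility only sees the absolute difference, so `d` may also lie above `x`; then their
  -- difference is a multiple of 8 below 8 and vanishes.
  ... | inj₂ x≤e = e , 0 , refl , e≤7 , trans (≤-antisym x≤e (m∸n≡0⇒m≤n (e∸x≡0 k k8))) (sym (+-identityʳ e))
    where
    k8 : e ∸ x ≡ k * 8
    k8 = trans (sym (trans (ℤ.∣m⊖n∣≡∣n⊖m∣ e x) (ℤ.∣⊖∣-≤ x≤e))) (trans (cong ℤ.∣_∣ (sym (ℤ.m-n≡m⊖n e x))) eq)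
    e∸x≡0 : ∀ k → e ∸ x ≡ k * 8 → e ∸ x ≡ 0
    e∸x≡0 zero    eq = eq
    e∸x≡0 (suc k) eq = contradiction (≤-trans (≤-trans (m≤m+n 8 (k * 8)) (≤-reflexive (sym eq))) (≤-trans (m∸n≤m e x) e≤7)) 8≰7
      where
      8≰7 : ¬ (8 ≤ 7)
      8≰7 (s≤s (s≤s (s≤s (s≤s (s≤s (s≤s (s≤s ())))))))

  open4-distance : ∀ {e} → e ≤ 7 → + open4 e ≡ + ℤ.∣ + 4 ℤ.- + e ∣ × + (4 ∸ open4 e) ≡ + 4 ℤ.- + ℤ.∣ + 4 ℤ.- + e ∣
  open4-distance {0} _ = refl , refl
  open4-distance {1} _ = refl , refl
  open4-distance {2} _ = refl , refl
  open4-distance {3} _ = refl , refl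
  open4-distance {4} _ = refl , refl
  open4-distance {5} _ = refl , refl
  open4-distance {6} _ = refl , refl
  open4-distance {7} _ = refl , refl
  open4-distance {suc (suc (suc (suc (suc (suc (suc (suc _)))))))} (s≤s (s≤s (s≤s (s≤s (s≤s (s≤s (s≤s ())))))))

  fold-open4-residue : ∀ f {x} → x ≤ 1 + 4 * f → (d : ℤ) → + 0 ≤ᶻ d → d ≤ᶻ + 7 → d ≡ + x [mod 8 ] →
    (¬ (2 ℕ.∣ f) → + fold x open4 f ≡ + ℤ.∣ + 4 ℤ.- d ∣) × (2 ℕ.∣ f → + fold x open4 f ≡ + 4 ℤ.- + ℤ.∣ + 4 ℤ.- d ∣)
  fold-open4-residue f x≤ d 0≤d d≤7 d≡x with e , k , refl , e≤7 , refl ← residue d 0≤d d≤7 d≡x = odd-case , even-case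
    where
    odd-case : ¬ (2 ℕ.∣ f) → + fold (e + k * 8) open4 f ≡ + ℤ.∣ + 4 ℤ.- + e ∣
    odd-case ¬2∣ with q , refl ← half-odd f ¬2∣ = trans (cong +_ (reflect-odd q k e≤7 x≤)) (proj₁ (open4-distance e≤7))
    even-case : 2 ℕ.∣ f → + fold (e + k * 8) open4 f ≡ + 4 ℤ.- + ℤ.∣ + 4 ℤ.- + e ∣
    even-case (divides q refl) = trans (cong +_ (reflect-even q k e≤7 x≤)) (proj₂ (open4-distance e≤7))

-- Positions as disjoint unions of paths and loops; moves as cuts.

module Positions where

  open import Data.Bool using (Bool; true; false)
  open import Data.Fin using (Fin; zero; suc)
  open import Data.Fin.Subset using (Subset; inside; outside; ⊥; ⁅_⁆; _∪_; _─_; ⋃)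
    renaming (_∈_ to _∈ˢ_; ∣_∣ to size)
  open import Data.Fin.Subset.Properties
    using (∪-assoc; ∪-comm; ∪-idem; ∪-identityˡ; ∪-identityʳ; ∪-isCommutativeMonoid; x∈p∪q⁻; x∈⁅y⁆⇒x≡y; ∉⊥)
  open import Data.List using (List; []; _∷_; [_]; _++_; map; concatMap; length)
  open import Data.List.Membership.Propositional using (_∈_; find)
  open import Data.List.Membership.Propositional.Properties using (∈-∃++; ∈-concatMap⁻)
  open import Data.List.Properties
    using (++-identityʳ; ++-assoc; map-++; length-++; concatMap-++; ∷-injective)
  open import Data.List.Relation.Binary.Permutation.Propositional
    using (_↭_; prep; swap; refl; trans; ↭-refl; ↭-sym; ↭-trans; ↭-reflexive; ↭⇒↭ₛ)
  open import Data.List.Relation.Binary.Permutation.Propositional.Properties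
    using (shift; shifts; drop-∷; ∈-resp-↭; map⁺; ++-comm)
    renaming (++⁺ˡ to ↭-++⁺ˡ; ++⁺ʳ to ↭-++⁺ʳ)
  import Data.List.Relation.Binary.Permutation.Setoid.Properties as Perm
  open import Data.List.Relation.Binary.Sublist.Propositional using (_⊆_; []; _∷_; _∷ʳ_; ⊆-refl)
  open import Data.List.Relation.Binary.Sublist.Propositional.Properties
    using (All-resp-⊆) renaming (++⁺ to ⊆-++⁺)
  open import Data.List.Relation.Unary.All using (All; []; _∷_)
  open import Data.List.Relation.Unary.AllPairs using ([]; _∷_)
  open import Data.List.Relation.Unary.Any using (here; there)
  open import Data.List.Relation.Unary.Unique.Propositional using (Unique)
  open import Data.Nat using (ℕ; zero; suc; _+_; _≤_; z≤n; s≤s)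
  open import Data.Nat.ListAction using (sum)
  open import Data.Nat.ListAction.Properties using (sum-++; sum-↭)
  open import Data.Nat.Properties using (+-suc; +-cancelʳ-≡; +-assoc)
  open import Data.Product using (∃; ∃₂; _×_; _,_)
  open import Data.Sum using (inj₁; inj₂)
  open import Data.Vec using (Vec; []; _∷_; here; there; lookup; removeAt; toList)
  open import Defs using (Line; claimed)
  open import Relation.Binary.PropositionalEquality as ≡
    using (_≡_; _≢_; refl; sym; cong; cong₂; setoid; module ≡-Reasoning)
  open import Relation.Nullary using (¬_; contradiction)

  private variable
    n : ℕ

  -- The flags of a path tell whether its first and its last box still have
  -- their end line.
  data Component (n : ℕ) : Set where
    path : (l r : Bool) → List (Fin n) → Component n
    loop : List (Fin n) → Component n

  boxesOf : Component n → List (Fin n)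
  boxesOf (path _ _ bs) = bs
  boxesOf (loop bs)     = bs

  ground : Bool → List (Subset n)
  ground true  = [ ⊥ ]
  ground false = []

  first : List (Fin n) → List (Subset n)
  first []      = []
  first (b ∷ _) = [ ⁅ b ⁆ ]

  -- The lines of a component are the unions of consecutive nodes, where an end
  -- line is the union with ⊥.
  nodes : Component n → List (Subset n)
  nodes (path l r bs) = ground l ++ map ⁅_⁆ bs ++ ground r
  nodes (loop bs)     = map ⁅_⁆ bs ++ first bs

  joins : List (Subset n) → List (Line n)
  joins (p ∷ q ∷ ps) = (p ∪ q) ∷ joins (q ∷ ps)
  joins _            = []

  linesOf : Component n → List (Line n)
  linesOf c = joins (nodes c)

  infix 4 _⟶_
  -- An empty part means that the end line itself is drawn, so the side conditions ask for that line
  -- to be present. Parts without lines stay in the list as inert components. A loop reopens just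
  -- behind the drawn line, hence the rotated order.
  data _⟶_ {n} : Component n → List (Component n) → Set where
    cutPath : ∀ {l r} xs ys → (xs ≡ [] → l ≡ true) → (ys ≡ [] → r ≡ true) →
              path l r (xs ++ ys) ⟶ path l false xs ∷ path false r ys ∷ []
    cutLoop : ∀ b xs ys → loop (b ∷ xs ++ ys) ⟶ path false false (ys ++ b ∷ xs) ∷ []

  joins-++ : ∀ (p : Subset n) ps q qs →
             ∃ λ e → joins (p ∷ ps ++ q ∷ qs) ↭ e ∷ joins (p ∷ ps) ++ joins (q ∷ qs)
  joins-++ p []        q qs = p ∪ q , ↭-refl
  joins-++ p (p′ ∷ ps) q qs with joins-++ p′ ps q qs
  ... | e , σ = e , ↭-trans (prep _ σ) (swap _ _ ↭-refl)

  joins-overlap : ∀ (ps : List (Subset n)) q qs →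
                  joins (ps ++ q ∷ qs) ≡ joins (ps ++ [ q ]) ++ joins (q ∷ qs)
  joins-overlap []            q qs = refl
  joins-overlap (p ∷ [])      q qs = refl
  joins-overlap (p ∷ p′ ∷ ps) q qs = cong ((p ∪ p′) ∷_) (joins-overlap (p′ ∷ ps) q qs)

  joins-split : ∀ {e : Line n} zs → e ∈ joins zs →
                ∃₂ λ p ps → ∃₂ λ q qs → zs ≡ p ∷ ps ++ q ∷ qs ×
                joins zs ↭ e ∷ joins (p ∷ ps) ++ joins (q ∷ qs)
  joins-split (p ∷ q ∷ zs) (here refl) = p , [] , q , zs , refl , ↭-refl
  joins-split (p ∷ q ∷ zs) (there e∈) with joins-split (q ∷ zs) e∈
  ... | p′ , ps , q′ , qs , refl , σ =
    p , p′ ∷ ps , q′ , qs , refl , ↭-trans (prep _ σ) (swap _ _ ↭-refl)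

  private
    path-nodes : ∀ l r (xs ys : List (Fin n)) →
                 nodes (path l r (xs ++ ys)) ≡ nodes (path l false xs) ++ nodes (path false r ys)
    path-nodes l r xs ys = begin
      ground l ++ map ⁅_⁆ (xs ++ ys) ++ ground r          ≡⟨ cong (λ z → ground l ++ z ++ ground r) (map-++ ⁅_⁆ xs ys) ⟩
      ground l ++ (map ⁅_⁆ xs ++ map ⁅_⁆ ys) ++ ground r  ≡⟨ cong (ground l ++_) (++-assoc (map ⁅_⁆ xs) _ _) ⟩
      ground l ++ map ⁅_⁆ xs ++ map ⁅_⁆ ys ++ ground r    ≡⟨ ++-assoc (ground l) _ _ ⟨
      (ground l ++ map ⁅_⁆ xs) ++ map ⁅_⁆ ys ++ ground r  ≡⟨ cong (λ z → (ground l ++ z) ++ _) (++-identityʳ _) ⟨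
      (ground l ++ map ⁅_⁆ xs ++ []) ++ map ⁅_⁆ ys ++ ground r ∎
      where open ≡-Reasoning

    loop-nodes : ∀ (b : Fin n) xs ys → nodes (loop (b ∷ xs ++ ys)) ≡ (⁅ b ⁆ ∷ map ⁅_⁆ xs) ++ (map ⁅_⁆ ys ++ [ ⁅ b ⁆ ])
    loop-nodes b xs ys = cong (⁅ b ⁆ ∷_)
      (≡.trans (cong (_++ [ ⁅ b ⁆ ]) (map-++ ⁅_⁆ xs ys)) (++-assoc (map ⁅_⁆ xs) (map ⁅_⁆ ys) [ ⁅ b ⁆ ]))

    open-nodes : ∀ (ys : List (Fin n)) b xs → nodes (path false false (ys ++ b ∷ xs)) ≡ map ⁅_⁆ ys ++ ⁅ b ⁆ ∷ map ⁅_⁆ xs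
    open-nodes ys b xs = ≡.trans (++-identityʳ _) (map-++ ⁅_⁆ ys (b ∷ xs))

    -- Removing the line of a loop between xs and ys ++ [ b ] glues the two rests at b.
    loop-rest : ∀ (b : Fin n) xs ys →
                joins (⁅ b ⁆ ∷ map ⁅_⁆ xs) ++ joins (map ⁅_⁆ ys ++ [ ⁅ b ⁆ ]) ↭
                linesOf (path false false (ys ++ b ∷ xs)) ++ []
    loop-rest b xs ys = ↭-trans (++-comm (joins (⁅ b ⁆ ∷ map ⁅_⁆ xs)) _) (↭-reflexive (sym (begin
      linesOf (path false false (ys ++ b ∷ xs)) ++ []  ≡⟨ ++-identityʳ _ ⟩
      linesOf (path false false (ys ++ b ∷ xs))        ≡⟨ cong joins (open-nodes ys b xs) ⟩
      joins (map ⁅_⁆ ys ++ ⁅ b ⁆ ∷ map ⁅_⁆ xs)         ≡⟨ joins-overlap (map ⁅_⁆ ys) ⁅ b ⁆ (map ⁅_⁆ xs) ⟩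
      joins (map ⁅_⁆ ys ++ [ ⁅ b ⁆ ]) ++ joins (⁅ b ⁆ ∷ map ⁅_⁆ xs) ∎)))
      where open ≡-Reasoning

    joins-++′ : ∀ (ps qs : List (Subset n)) → ps ≢ [] → qs ≢ [] →
                ∃ λ e → joins (ps ++ qs) ↭ e ∷ joins ps ++ joins qs
    joins-++′ []       qs       p≢ q≢ = contradiction refl p≢
    joins-++′ (p ∷ ps) []       p≢ q≢ = contradiction refl q≢
    joins-++′ (p ∷ ps) (q ∷ qs) p≢ q≢ = joins-++ p ps q qs

    nodesˡ≢[] : ∀ l (xs : List (Fin n)) → (xs ≡ [] → l ≡ true) → nodes (path l false xs) ≢ []
    nodesˡ≢[] true  xs       _ ()
    nodesˡ≢[] false (x ∷ xs) _ ()
    nodesˡ≢[] false []       l eq with () ← l refl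

    nodesʳ≢[] : ∀ r (ys : List (Fin n)) → (ys ≡ [] → r ≡ true) → nodes (path false r ys) ≢ []
    nodesʳ≢[] true  []       _ ()
    nodesʳ≢[] true  (x ∷ xs) _ ()
    nodesʳ≢[] false (x ∷ xs) _ ()
    nodesʳ≢[] false []       l eq with () ← l refl

    ∷ʳ≢[] : ∀ {A : Set} (as : List A) {a} → as ++ [ a ] ≢ []
    ∷ʳ≢[] []      ()
    ∷ʳ≢[] (_ ∷ _) ()

  -- Turns a chosen cut into a move, as needed to exhibit a good move. The opposite direction,
  -- `line-cut`, turns an arbitrary move into a cut, as needed to bound all moves.
  cut-line : ∀ {c : Component n} {cs} → c ⟶ cs → ∃ λ e → linesOf c ↭ e ∷ concatMap linesOf cs
  cut-line (cutPath {l} {r} xs ys l-ok r-ok)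
    with e , σ ← joins-++′ _ _ (nodesˡ≢[] l xs l-ok) (nodesʳ≢[] r ys r-ok) =
    e , ↭-trans (↭-reflexive (cong joins (path-nodes l r xs ys)))
      (↭-trans σ (prep e (↭-++⁺ˡ (linesOf (path l false xs)) (↭-reflexive (sym (++-identityʳ _))))))
  cut-line (cutLoop b xs ys)
    with e , σ ← joins-++′ (⁅ b ⁆ ∷ map ⁅_⁆ xs) (map ⁅_⁆ ys ++ [ ⁅ b ⁆ ]) (λ ()) (∷ʳ≢[] (map ⁅_⁆ ys)) =
    e , ↭-trans (↭-reflexive (cong joins (loop-nodes b xs ys))) (↭-trans σ (prep e (loop-rest b xs ys)))

  private
    -- The second part is non-empty, so it contains the whole tail when that has at most one node;
    -- the split therefore falls among the boxes.
    map-split : ∀ {A : Set} (f : Fin n → A) bs tail us q qs → length tail ≤ 1 →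
                map f bs ++ tail ≡ us ++ q ∷ qs →
                ∃₂ λ xs ys → bs ≡ xs ++ ys × us ≡ map f xs × q ∷ qs ≡ map f ys ++ tail
    map-split f bs       tail        []       q qs _ eq = [] , bs , refl , refl , sym eq
    map-split f (b ∷ bs) tail        (u ∷ us) q qs t eq
      with refl , eq′ ← ∷-injective eq with map-split f bs tail us q qs t eq′
    ... | xs , ys , refl , refl , eq″ = b ∷ xs , ys , refl , refl , eq″
    map-split f []       (_ ∷ [])     (u ∷ [])     q qs _ ()
    map-split f []       (_ ∷ [])     (u ∷ _ ∷ us) q qs _ ()
    map-split f []       (_ ∷ _ ∷ _)  (u ∷ us)     q qs (s≤s ()) eq

    ground≤1 : ∀ r → length (ground {n} r) ≤ 1
    ground≤1 true  = s≤s z≤n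
    ground≤1 false = z≤n

    line-cut-path : ∀ {e : Line n} l r bs → bs ≢ [] → e ∈ linesOf (path l r bs) →
                    ∃ λ cs → path l r bs ⟶ cs × linesOf (path l r bs) ↭ e ∷ concatMap linesOf cs
    line-cut-path {n} {e} l r bs bs≢ e∈ with joins-split (nodes (path l r bs)) e∈
    ... | p , ps , q , qs , eq , σ = go l r bs eq σ
      where
      finish : ∀ l r (xs ys : List (Fin n)) → p ∷ ps ≡ nodes (path l false xs) → q ∷ qs ≡ nodes (path false r ys) →
               linesOf (path l r (xs ++ ys)) ↭ e ∷ joins (p ∷ ps) ++ joins (q ∷ qs) →
               ∃ λ cs → path l r (xs ++ ys) ⟶ cs × linesOf (path l r (xs ++ ys)) ↭ e ∷ concatMap linesOf cs
      finish l r xs ys eqˡ eqʳ σ =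
        _ , cutPath xs ys (okˡ l xs eqˡ) (okʳ r ys eqʳ) ,
        ↭-trans σ (prep e (↭-reflexive (cong₂ (λ x y → joins x ++ y) eqˡ (≡.trans (cong joins eqʳ) (sym (++-identityʳ _))))))
        where
        okˡ : ∀ l (xs : List (Fin n)) → p ∷ ps ≡ nodes (path l false xs) → xs ≡ [] → l ≡ true
        okˡ true  xs _ _ = refl
        okˡ false [] () _
        okʳ : ∀ r (ys : List (Fin n)) → q ∷ qs ≡ nodes (path false r ys) → ys ≡ [] → r ≡ true
        okʳ true  xs _ _ = refl
        okʳ false [] () _
      go : ∀ l r (bs : List (Fin n)) → nodes (path l r bs) ≡ p ∷ ps ++ q ∷ qs →
           linesOf (path l r bs) ↭ e ∷ joins (p ∷ ps) ++ joins (q ∷ qs) →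
           ∃ λ cs → path l r bs ⟶ cs × linesOf (path l r bs) ↭ e ∷ concatMap linesOf cs
      go false r bs eq σ with map-split ⁅_⁆ bs (ground r) (p ∷ ps) q qs (ground≤1 {n} r) eq
      ... | xs , ys , refl , eqˡ , eqʳ = finish false r xs ys (≡.trans eqˡ (sym (++-identityʳ _))) eqʳ σ
      go true r bs eq σ with refl , eq′ ← ∷-injective eq
        with map-split ⁅_⁆ bs (ground r) ps q qs (ground≤1 {n} r) eq′
      ... | xs , ys , refl , eqˡ , eqʳ = finish true r xs ys (cong (⊥ ∷_) (≡.trans eqˡ (sym (++-identityʳ _)))) eqʳ σ

  line-cut : ∀ {e : Line n} c → boxesOf c ≢ [] → e ∈ linesOf c →
             ∃ λ cs → c ⟶ cs × linesOf c ↭ e ∷ concatMap linesOf cs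
  line-cut (path l r bs)   ne e∈ = line-cut-path l r bs ne e∈
  line-cut (loop [])       ne ()
  line-cut (loop (b ∷ bs)) ne e∈ with joins-split (nodes (loop (b ∷ bs))) e∈
  ... | p , ps , q , qs , eq , σ with map-split ⁅_⁆ (b ∷ bs) [ ⁅ b ⁆ ] (p ∷ ps) q qs (s≤s z≤n) eq
  ... | x ∷ xs , ys , refl , refl , eqʳ =
    _ , cutLoop x xs ys , ↭-trans σ (prep _ (↭-trans
      (↭-reflexive (cong (λ z → joins (⁅ b ⁆ ∷ map ⁅_⁆ xs) ++ joins z) eqʳ)) (loop-rest b xs ys)))

  -- A path of one box without end lines has no lines, so its box is claimed.
  live : Component n → List (Fin n)
  live (path false false (_ ∷ [])) = []
  live (path _ _ bs)               = bs
  live (loop bs)                   = bs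

  -- Unclaimed boxes, and the boxes claimed by a move.

  ⋃-++ : ∀ (ps qs : List (Subset n)) → ⋃ (ps ++ qs) ≡ ⋃ ps ∪ ⋃ qs
  ⋃-++ []       qs = sym (∪-identityˡ (⋃ qs))
  ⋃-++ (p ∷ ps) qs = ≡.trans (cong (p ∪_) (⋃-++ ps qs)) (sym (∪-assoc p _ _))

  -- With two or more nodes each node takes part in some join. A single node has none and would be
  -- lost, which is the case that `live` singles out.
  ⋃-joins : ∀ (ps : List (Subset n)) → 2 ≤ length ps → ⋃ (joins ps) ≡ ⋃ ps
  ⋃-joins (p ∷ [])         (s≤s ())
  ⋃-joins (p ∷ q ∷ [])     _ = ∪-assoc p q ⊥
  ⋃-joins (p ∷ q ∷ r ∷ ps) _ = begin
    (p ∪ q) ∪ ⋃ (joins (q ∷ r ∷ ps)) ≡⟨ cong ((p ∪ q) ∪_) (⋃-joins (q ∷ r ∷ ps) (s≤s (s≤s z≤n))) ⟩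
    (p ∪ q) ∪ (q ∪ X)                ≡⟨ ∪-assoc p q _ ⟩
    p ∪ (q ∪ (q ∪ X))                ≡⟨ cong (p ∪_) (sym (∪-assoc q q X)) ⟩
    p ∪ ((q ∪ q) ∪ X)                ≡⟨ cong (λ z → p ∪ (z ∪ X)) (∪-idem q) ⟩
    p ∪ (q ∪ X)                      ∎
    where
    open ≡-Reasoning
    X = ⋃ (r ∷ ps)

  private
    ⋃-ground : ∀ b → ⋃ (ground {n} b) ≡ ⊥
    ⋃-ground true  = ∪-identityˡ ⊥
    ⋃-ground false = refl

    ⋃-path-nodes : ∀ l r (bs : List (Fin n)) → ⋃ (nodes (path l r bs)) ≡ ⋃ (map ⁅_⁆ bs)
    ⋃-path-nodes {n} l r bs = begin
      ⋃ (ground l ++ map ⁅_⁆ bs ++ ground r)             ≡⟨ ⋃-++ (ground l) _ ⟩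
      ⋃ (ground l) ∪ ⋃ (map ⁅_⁆ bs ++ ground r)          ≡⟨ cong₂ _∪_ (⋃-ground {n} l) (⋃-++ (map ⁅_⁆ bs) _) ⟩
      ⊥ ∪ (⋃ (map ⁅_⁆ bs) ∪ ⋃ (ground r))                ≡⟨ ∪-identityˡ _ ⟩
      ⋃ (map ⁅_⁆ bs) ∪ ⋃ (ground r)                      ≡⟨ cong (_ ∪_) (⋃-ground {n} r) ⟩
      ⋃ (map ⁅_⁆ bs) ∪ ⊥                                 ≡⟨ ∪-identityʳ _ ⟩
      ⋃ (map ⁅_⁆ bs)                                     ∎
      where open ≡-Reasoning

    ⋃-loop-nodes : ∀ (b : Fin n) bs → ⋃ (nodes (loop (b ∷ bs))) ≡ ⋃ (map ⁅_⁆ (b ∷ bs))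
    ⋃-loop-nodes b bs = begin
      ⋃ (map ⁅_⁆ (b ∷ bs) ++ [ ⁅ b ⁆ ])     ≡⟨ ⋃-++ (map ⁅_⁆ (b ∷ bs)) _ ⟩
      (⁅ b ⁆ ∪ X) ∪ (⁅ b ⁆ ∪ ⊥)             ≡⟨ cong ((⁅ b ⁆ ∪ X) ∪_) (∪-identityʳ ⁅ b ⁆) ⟩
      (⁅ b ⁆ ∪ X) ∪ ⁅ b ⁆                   ≡⟨ ∪-comm _ ⁅ b ⁆ ⟩
      ⁅ b ⁆ ∪ (⁅ b ⁆ ∪ X)                   ≡⟨ sym (∪-assoc ⁅ b ⁆ ⁅ b ⁆ X) ⟩
      (⁅ b ⁆ ∪ ⁅ b ⁆) ∪ X                   ≡⟨ cong (_∪ X) (∪-idem ⁅ b ⁆) ⟩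
      ⁅ b ⁆ ∪ X                             ∎
      where
      open ≡-Reasoning
      X = ⋃ (map ⁅_⁆ bs)

  ⋃-linesOf : ∀ (c : Component n) → ⋃ (linesOf c) ≡ ⋃ (map ⁅_⁆ (live c))
  ⋃-linesOf c@(path true true [])              = ≡.trans (⋃-joins (nodes c) (s≤s (s≤s z≤n))) (⋃-path-nodes true true [])
  ⋃-linesOf (path true false [])               = refl
  ⋃-linesOf c@(path true r bs@(_ ∷ _))         = ≡.trans (⋃-joins (nodes c) (s≤s (s≤s z≤n))) (⋃-path-nodes true r bs)
  ⋃-linesOf (path false true [])               = refl
  ⋃-linesOf c@(path false true bs@(_ ∷ []))    = ≡.trans (⋃-joins (nodes c) (s≤s (s≤s z≤n))) (⋃-path-nodes false true bs)
  ⋃-linesOf c@(path false true bs@(_ ∷ _ ∷ _)) = ≡.trans (⋃-joins (nodes c) (s≤s (s≤s z≤n))) (⋃-path-nodes false true bs)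
  ⋃-linesOf (path false false [])              = refl
  ⋃-linesOf (path false false (_ ∷ []))        = refl
  ⋃-linesOf c@(path false false bs@(_ ∷ _ ∷ _)) = ≡.trans (⋃-joins (nodes c) (s≤s (s≤s z≤n))) (⋃-path-nodes false false bs)
  ⋃-linesOf (loop [])                          = refl
  ⋃-linesOf c@(loop (b ∷ []))                  = ≡.trans (⋃-joins (nodes c) (s≤s (s≤s z≤n))) (⋃-loop-nodes b [])
  ⋃-linesOf c@(loop (b ∷ b′ ∷ bs))             = ≡.trans (⋃-joins (nodes c) (s≤s (s≤s z≤n))) (⋃-loop-nodes b (b′ ∷ bs))

  ⋃-position : ∀ (P : List (Component n)) → ⋃ (concatMap linesOf P) ≡ ⋃ (map ⁅_⁆ (concatMap live P))
  ⋃-position []      = refl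
  ⋃-position (c ∷ P) = begin
    ⋃ (linesOf c ++ concatMap linesOf P)                       ≡⟨ ⋃-++ (linesOf c) _ ⟩
    ⋃ (linesOf c) ∪ ⋃ (concatMap linesOf P)                    ≡⟨ cong₂ _∪_ (⋃-linesOf c) (⋃-position P) ⟩
    ⋃ (map ⁅_⁆ (live c)) ∪ ⋃ (map ⁅_⁆ (concatMap live P))      ≡⟨ sym (⋃-++ (map ⁅_⁆ (live c)) _) ⟩
    ⋃ (map ⁅_⁆ (live c) ++ map ⁅_⁆ (concatMap live P))         ≡⟨ cong ⋃ (sym (map-++ ⁅_⁆ (live c) _)) ⟩
    ⋃ (map ⁅_⁆ (concatMap live (c ∷ P)))                       ∎
    where open ≡-Reasoning

  -- Makes the number of claimed boxes the drop in the number of unclaimed ones, a quantity that is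
  -- additive over components.
  size-─-+ : ∀ (p q : Subset n) → size (p ─ q) + size q ≡ size (p ∪ q)
  size-─-+ []            []            = refl
  size-─-+ (inside ∷ p)  (inside ∷ q)  = ≡.trans (+-suc _ _) (cong suc (size-─-+ p q))
  size-─-+ (inside ∷ p)  (outside ∷ q) = cong suc (size-─-+ p q)
  size-─-+ (outside ∷ p) (inside ∷ q)  = ≡.trans (+-suc _ _) (cong suc (size-─-+ p q))
  size-─-+ (outside ∷ p) (outside ∷ q) = size-─-+ p q

  size-⁅⁆∪ : ∀ (x : Fin n) p → ¬ (x ∈ˢ p) → size (⁅ x ⁆ ∪ p) ≡ suc (size p)
  size-⁅⁆∪ zero    (inside ∷ p)  x∉ = contradiction here x∉
  size-⁅⁆∪ zero    (outside ∷ p) x∉ = cong (λ z → suc (size z)) (∪-identityˡ p)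
  size-⁅⁆∪ (suc x) (inside ∷ p)  x∉ = cong suc (size-⁅⁆∪ x p (λ x∈ → x∉ (there x∈)))
  size-⁅⁆∪ (suc x) (outside ∷ p) x∉ = size-⁅⁆∪ x p (λ x∈ → x∉ (there x∈))

  size-⋃-⁅⁆ : ∀ {bs : List (Fin n)} → Unique bs → size (⋃ (map ⁅_⁆ bs)) ≡ length bs
  size-⋃-⁅⁆ {n} {bs = []} [] = size-⊥ n
    where
    size-⊥ : ∀ n → size (⊥ {n}) ≡ 0
    size-⊥ zero    = refl
    size-⊥ (suc n) = size-⊥ n
  size-⋃-⁅⁆ {bs = b ∷ bs} (b∉ ∷ u) = ≡.trans (size-⁅⁆∪ b _ (∉⋃ bs b∉)) (cong suc (size-⋃-⁅⁆ u))
    where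
    ∉⋃ : ∀ bs → All (b ≢_) bs → ¬ (b ∈ˢ ⋃ (map ⁅_⁆ bs))
    ∉⋃ []        []         b∈ = ∉⊥ b∈
    ∉⋃ (b′ ∷ bs) (b≢ ∷ b∉) b∈ with x∈p∪q⁻ ⁅ b′ ⁆ _ b∈
    ... | inj₁ b∈₁ = b≢ (x∈⁅y⁆⇒x≡y b′ b∈₁)
    ... | inj₂ b∈₂ = ∉⋃ bs b∉ b∈₂

  module _ {A : Set} where
    Unique-⊆ : ∀ {xs ys : List A} → xs ⊆ ys → Unique ys → Unique xs
    Unique-⊆ []         u       = u
    Unique-⊆ (_ ∷ʳ σ)   (_ ∷ u) = Unique-⊆ σ u
    Unique-⊆ (refl ∷ σ) (∉ ∷ u) = All-resp-⊆ σ ∉ ∷ Unique-⊆ σ u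

    Unique-↭ : ∀ {xs ys : List A} → xs ↭ ys → Unique xs → Unique ys
    Unique-↭ σ = Perm.Unique-resp-↭ (setoid A) (↭⇒↭ₛ σ)

  concatMap-↭ : ∀ {A B : Set} (f : A → List B) {xs ys} → xs ↭ ys → concatMap f xs ↭ concatMap f ys
  concatMap-↭ f refl         = ↭-refl
  concatMap-↭ f (prep x σ)   = ↭-++⁺ˡ (f x) (concatMap-↭ f σ)
  concatMap-↭ f (swap x y σ) = ↭-trans (shifts (f x) (f y)) (↭-++⁺ˡ (f y) (↭-++⁺ˡ (f x) (concatMap-↭ f σ)))
  concatMap-↭ f (trans σ τ)  = ↭-trans (concatMap-↭ f σ) (concatMap-↭ f τ)

  live-⊆ : ∀ (P : List (Component n)) → concatMap live P ⊆ concatMap boxesOf P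
  live-⊆ []      = []
  live-⊆ (c ∷ P) = ⊆-++⁺ (go c) (live-⊆ P)
    where
    go : ∀ c → live c ⊆ boxesOf c
    go (path false false [])           = []
    go (path false false (b ∷ []))     = b ∷ʳ []
    go (path false false (_ ∷ _ ∷ _))  = ⊆-refl
    go (path false true bs)            = ⊆-refl
    go (path true r bs)                = ⊆-refl
    go (loop bs)                       = ⊆-refl

  touched : Component n → ℕ
  touched c = length (live c)

  total : (Component n → ℕ) → List (Component n) → ℕ
  total φ P = sum (map φ P)

  total-++ : ∀ φ (P Q : List (Component n)) → total φ (P ++ Q) ≡ total φ P + total φ Q
  total-++ φ P Q = ≡.trans (cong sum (map-++ φ P Q)) (sum-++ (map φ P) (map φ Q))

  total-↭ : ∀ φ {P Q : List (Component n)} → P ↭ Q → total φ P ≡ total φ Q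
  total-↭ φ σ = sum-↭ (map⁺ φ σ)

  -- Lines are matched only up to permutation, since deleting a list entry and cutting a component
  -- order the remaining lines differently. Distinct boxes let the unclaimed boxes of the components
  -- be counted separately.
  record Realises (ls : List (Line n)) (P : List (Component n)) : Set where
    constructor realises
    field
      lines-↭      : ls ↭ concatMap linesOf P
      boxes-unique : Unique (concatMap boxesOf P)

  open Realises

  ⋃-↭ : ∀ {ps qs : List (Subset n)} → ps ↭ qs → ⋃ ps ≡ ⋃ qs
  ⋃-↭ {n} σ = Perm.foldr-commMonoid (setoid (Subset n)) (∪-isCommutativeMonoid n) (↭⇒↭ₛ σ)

  size-⋃ : ∀ {ls : List (Line n)} {P} → Realises ls P → size (⋃ ls) ≡ total touched P
  size-⋃ {ls = ls} {P} (realises σ u) = begin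
    size (⋃ ls)                                ≡⟨ cong size (⋃-↭ σ) ⟩
    size (⋃ (concatMap linesOf P))             ≡⟨ cong size (⋃-position P) ⟩
    size (⋃ (map ⁅_⁆ (concatMap live P)))      ≡⟨ size-⋃-⁅⁆ (Unique-⊆ (live-⊆ P) u) ⟩
    length (concatMap live P)                  ≡⟨ go P ⟩
    total touched P                            ∎
    where
    open ≡-Reasoning
    go : ∀ P → length (concatMap live P) ≡ total touched P
    go []      = refl
    go (c ∷ P) = ≡.trans (length-++ (live c)) (cong (_+_ (touched c)) (go P))

  cut-boxes : ∀ {c : Component n} {cs} → c ⟶ cs → concatMap boxesOf cs ↭ boxesOf c
  cut-boxes (cutPath xs ys _ _) = ↭-reflexive (cong (xs ++_) (++-identityʳ ys))
  cut-boxes (cutLoop b xs ys)   = ↭-trans (↭-reflexive (++-identityʳ _)) (++-comm ys (b ∷ xs))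

  private
    -- The count compares the unclaimed boxes of the whole position before and after the move; the
    -- components in `Q` contribute equally to both and cancel.
    cut-step : ∀ {ls : List (Line n)} {P c Q cs e} rest →
               Realises ls P → P ↭ c ∷ Q → c ⟶ cs → linesOf c ↭ e ∷ concatMap linesOf cs → ls ↭ e ∷ rest →
               Realises rest (cs ++ Q) × size (e ─ ⋃ rest) + total touched cs ≡ touched c
    cut-step {ls = ls} {P} {c} {Q} {cs} {e} rest r@(realises lines↭ unique) P↭ cut c-lines ls↭ = r′ ,
      +-cancelʳ-≡ (total touched Q) _ _ (begin
        size (e ─ ⋃ rest) + total touched cs + total touched Q   ≡⟨ +-assoc (size (e ─ ⋃ rest)) _ _ ⟩
        size (e ─ ⋃ rest) + (total touched cs + total touched Q) ≡⟨ cong (_+_ _) (sym (total-++ touched cs Q)) ⟩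
        size (e ─ ⋃ rest) + total touched (cs ++ Q)              ≡⟨ cong (_+_ _) (sym (size-⋃ r′)) ⟩
        size (e ─ ⋃ rest) + size (⋃ rest)                        ≡⟨ size-─-+ e (⋃ rest) ⟩
        size (⋃ (e ∷ rest))                                      ≡⟨ cong size (sym (⋃-↭ ls↭)) ⟩
        size (⋃ ls)                                              ≡⟨ size-⋃ r ⟩
        total touched P                                          ≡⟨ total-↭ touched P↭ ⟩
        touched c + total touched Q                              ∎)
      where
      open ≡-Reasoning
      r′ : Realises rest (cs ++ Q)
      r′ .lines-↭ = drop-∷ (↭-trans (↭-sym ls↭) (↭-trans lines↭ (↭-trans (concatMap-↭ linesOf P↭)
        (↭-trans (↭-++⁺ʳ _ c-lines) (prep e (↭-reflexive (sym (concatMap-++ linesOf cs Q))))))))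
      r′ .boxes-unique = Unique-↭ (↭-trans (concatMap-↭ boxesOf P↭)
        (↭-trans (↭-++⁺ʳ _ (↭-sym (cut-boxes cut))) (↭-reflexive (sym (concatMap-++ boxesOf cs Q))))) unique

  lookup-removeAt-↭ : ∀ {A : Set} {m} (xs : Vec A (suc m)) i → toList xs ↭ lookup xs i ∷ toList (removeAt xs i)
  lookup-removeAt-↭ (x ∷ xs)         zero    = ↭-refl
  lookup-removeAt-↭ (x ∷ xs@(_ ∷ _)) (suc i) = ↭-trans (prep x (lookup-removeAt-↭ xs i)) (swap _ _ ↭-refl)

  lookup-∈ : ∀ {A : Set} {m} (xs : Vec A m) {x} → x ∈ toList xs → ∃ λ i → lookup xs i ≡ x
  lookup-∈ (x ∷ xs) (here refl) = zero , refl
  lookup-∈ (x ∷ xs) (there x∈) with i , eq ← lookup-∈ xs x∈ = suc i , eq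

  record Draw {m} (ls : Vec (Line n) (suc m)) (c : Component n) (Q cs : List (Component n)) (i : Fin (suc m)) : Set where
    constructor draw
    field
      cut      : c ⟶ cs
      realised : Realises (toList (removeAt ls i)) (cs ++ Q)
      count    : claimed (lookup ls i) (removeAt ls i) + total touched cs ≡ touched c

  ∈⇒↭ : ∀ {A : Set} {x : A} {xs} → x ∈ xs → ∃ λ ys → xs ↭ x ∷ ys
  ∈⇒↭ x∈ with ys , zs , refl ← ∈-∃++ x∈ = ys ++ zs , shift _ ys zs

  private
    nonEmpty : ∀ (c : Component n) {e} → c ≢ path true true [] → e ∈ linesOf c → boxesOf c ≢ []
    nonEmpty (path true true [])   ok e∈ _ = ok refl
    nonEmpty (path true false [])  ok ()
    nonEmpty (path false true [])  ok ()
    nonEmpty (path false false []) ok ()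
    nonEmpty (path l r (_ ∷ _))    ok e∈ ()
    nonEmpty (loop [])             ok ()
    nonEmpty (loop (_ ∷ _))        ok e∈ ()

  draw-cuts : ∀ {m} (ls : Vec (Line n) (suc m)) {P} → Realises (toList ls) P →
              (∀ {c} → c ∈ P → c ≢ path true true [])  → ∀ i →
              ∃₂ λ c Q → P ↭ c ∷ Q × ∃ λ cs → Draw ls c Q cs i
  draw-cuts ls {P} r ok i
    with c , c∈P , e∈c ← find (∈-concatMap⁻ linesOf (∈-resp-↭ (↭-trans (↭-sym (lookup-removeAt-↭ ls i)) (lines-↭ r)) (here refl)))
    with Q , P↭ ← ∈⇒↭ c∈P
    with cs , cut , c-lines ← line-cut c (nonEmpty c (ok c∈P) e∈c) e∈c
    with r′ , count ← cut-step _ r P↭ cut c-lines (lookup-removeAt-↭ ls i) =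
    c , Q , P↭ , cs , draw cut r′ count

  cut-draws : ∀ {m} (ls : Vec (Line n) (suc m)) {P c Q cs} → Realises (toList ls) P → P ↭ c ∷ Q → c ⟶ cs →
              ∃ λ i → Draw ls c Q cs i
  cut-draws ls r P↭ cut
    with e , c-lines ← cut-line cut
    with i , refl ← lookup-∈ ls (∈-resp-↭ (↭-sym (↭-trans (lines-↭ r) (↭-trans (concatMap-↭ linesOf P↭) (↭-++⁺ʳ _ c-lines)))) (here refl))
    with r′ , count ← cut-step _ r P↭ cut c-lines (lookup-removeAt-↭ ls i) =
    i , draw cut r′ count

-- The value formula for all positions arising in play.

module Evaluation where

  open import Data.Bool using (true; false)
  open import Data.Fin using (Fin; zero; suc)
  open import Data.Integer as ℤ using (ℤ; +_; _⊖_; 0ℤ; _⊓_) renaming (_≤_ to _≤ᶻ_)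
  import Data.Integer.Properties as ℤ
  open import Data.List using (List; []; _∷_; _++_; concatMap; length; initLast; _∷ʳ′_)
  open import Data.List.Properties using (length-++)
  open import Data.List.Relation.Binary.Permutation.Propositional
    using (_↭_; prep; swap; ↭-refl; ↭-sym; ↭-trans)
  open import Data.List.Relation.Binary.Permutation.Propositional.Properties
    using (All-resp-↭; ¬x∷xs↭[]) renaming (++⁺ʳ to ↭-++⁺ʳ)
  open import Data.List.Relation.Unary.All as All using (All; []; _∷_)
  import Data.List.Relation.Unary.All.Properties as All
  open import Data.Nat using (ℕ; zero; suc; _+_; _*_; _∸_; _≤_; _≤?_; z≤n; s≤s; s≤s⁻¹)
  open import Data.Nat.Properties
  open import Data.Nat.Tactic.RingSolver using (solve-∀)
  open import Data.Product using (∃; ∃₂; _×_; _,_; proj₁; proj₂)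
  open import Data.Sum using (_⊎_; inj₁; inj₂)
  open import Data.Vec using (Vec; []; lookup; removeAt; toList)
  import Data.Vec.Functional as Functional
  open import Defs using (Line; claimed; moveValue; minimum; value)
  open import Relation.Binary.PropositionalEquality
  open import Relation.Nullary using (¬_; yes; no; contradiction)
  open Values
  open Positions

  private variable
    n : ℕ

  -- Opened paths carry no length condition, since a cut may leave parts of any length, even empty
  -- ones. Chains with both end lines and loops are never produced by a cut, so they keep their
  -- original lengths.
  data Valid {n} : Component n → Set where
    chain : ∀ k {bs} → length bs ≡ 4 + k → Valid (path true true bs)
    left  : ∀ {l bs} → Valid (path l false bs)
    right : ∀ {r bs} → Valid (path false r bs)
    loop4 : ∀ {bs} → length bs ≡ 4 → Valid (loop bs)
    loop6 : ∀ {bs} → length bs ≡ 6 → Valid (loop bs)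
    loop8 : ∀ k {bs} → length bs ≡ 8 + k → Valid (loop bs)

  is4 is6 ≥8 ≥2 ≥4 : ℕ → ℕ
  is4 4 = 1
  is4 _ = 0
  is6 6 = 1
  is6 _ = 0
  ≥8 (suc (suc (suc (suc (suc (suc (suc (suc _)))))))) = 1
  ≥8 _ = 0
  ≥2 (suc (suc _)) = 1
  ≥2 _ = 0
  ≥4 (suc (suc (suc (suc _)))) = 1
  ≥4 _ = 0

  -- `excess` is the contribution to `fcv` of chains and of long loops; truncation makes it 0 for 4-
  -- and 6-loops, whose deficits `short` accounts for. `free` counts the boxes that can be taken one
  -- after another from an end without its end line.
  fours sixes longs chains excess free half quad : Component n → ℕ
  fours (loop bs) = is4 (length bs)
  fours _         = 0
  sixes (loop bs) = is6 (length bs)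
  sixes _         = 0
  longs (loop bs) = ≥8 (length bs)
  longs _         = 0
  chains (path true true _) = 1
  chains _                  = 0
  excess (path true true bs) = length bs ∸ 4
  excess (loop bs)           = length bs ∸ 8
  excess _                   = 0

  free (path true true _) = 0
  free (loop _)           = 0
  free c                  = touched c

  -- Paths from which the player to move can give two boxes, respectively four
  -- boxes, to the opponent in order to keep control.
  half (path true false bs) = ≥2 (length bs)
  half (path false true bs) = ≥2 (length bs)
  half _                    = 0
  quad (path false false bs) = ≥4 (length bs)
  quad _                     = 0

  -- `closedValue (loop bs ∷ Q)` with the length made a variable, so that a known length can be
  -- substituted for it.
  withLoop : ℕ → List (Component n) → ℕ
  withLoop l Q = closed (is4 l + total fours Q) (is6 l + total sixes Q) (total chains Q)
                        (≥8 l + total longs Q) (l ∸ 8 + total excess Q)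

  closedValue : List (Component n) → ℕ
  closedValue P = closed (total fours P) (total sixes P) (total chains P) (total longs P) (total excess P)

  opaque
    -- Half the gain from keeping control. Giving away two boxes is cheaper than four, so one path
    -- counted by `half` decides the matter.
    penalty : (a b v : ℕ) → ℕ
    penalty zero    zero    v = 0
    penalty zero    (suc _) v = v ∸ 4
    penalty (suc _) _       v = v ∸ 2

    penalty-mono : ∀ {a b a′ b′} v → a ≤ a′ → b ≤ b′ → penalty a b v ≤ penalty a′ b′ v
    penalty-mono {zero}  {zero}                   v a≤ b≤ = z≤n
    penalty-mono {zero}  {suc b} {zero}  {suc b′} v a≤ b≤ = ≤-refl
    penalty-mono {zero}  {suc b} {suc a′}         v a≤ b≤ = ∸-monoʳ-≤ v (m≤m+n 2 2)
    penalty-mono {suc a} {b}     {suc a′}         v a≤ b≤ = ≤-refl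

    penalty-none : ∀ v → penalty 0 0 v ≡ 0
    penalty-none v = refl

    penalty-zero : ∀ a b → penalty a b 0 ≡ 0
    penalty-zero zero    zero    = refl
    penalty-zero zero    (suc b) = refl
    penalty-zero (suc a) b       = refl

    penalty-half : ∀ a {b v} → 1 ≤ a → penalty a b v ≡ v ∸ 2
    penalty-half (suc a) _ = refl

    penalty-quad : ∀ b {v} → 1 ≤ b → penalty 0 b v ≡ v ∸ 4
    penalty-quad (suc b) _ = refl

    score : (v t p : ℕ) → ℤ
    score v t p = v ⊖ (t + 2 * p)

    score-def : ∀ v → score v 0 0 ≡ + v
    score-def v = refl

  half-penalty : ∀ {a} b v → 1 ≤ a → v ∸ 2 ≤ penalty a b v
  half-penalty {a} b v 1≤a = ≤-reflexive (sym (penalty-half a 1≤a))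

  quad-penalty : ∀ a {b} v → 1 ≤ b → v ∸ 4 ≤ penalty a b v
  quad-penalty a {b} v 1≤b = ≤-trans (≤-reflexive (sym (penalty-quad b 1≤b))) (penalty-mono v z≤n ≤-refl)

  penaltyOf : List (Component n) → ℕ
  penaltyOf P = penalty (total half P) (total quad P) (closedValue P)

  eval : List (Component n) → ℤ
  eval P = score (closedValue P) (total free P) (penaltyOf P)

  ≥2-mono : ∀ {m o} → m ≤ o → ≥2 m ≤ ≥2 o
  ≥2-mono z≤n             = z≤n
  ≥2-mono (s≤s z≤n)       = z≤n
  ≥2-mono (s≤s (s≤s m≤o)) = ≤-refl

  ≥4-mono : ∀ {m o} → m ≤ o → ≥4 m ≤ ≥4 o
  ≥4-mono z≤n                         = z≤n
  ≥4-mono (s≤s z≤n)                   = z≤n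
  ≥4-mono (s≤s (s≤s z≤n))             = z≤n
  ≥4-mono (s≤s (s≤s (s≤s z≤n)))       = z≤n
  ≥4-mono (s≤s (s≤s (s≤s (s≤s m≤o)))) = ≤-refl

  ⊖-mono : ∀ {m n p q} → m + q ≤ p + n → m ⊖ n ≤ᶻ p ⊖ q
  ⊖-mono {m} {n} {p} {q} le = subst₂ _≤ᶻ_ (ℤ.+-cancelˡ-⊖ q m n)
    (trans (cong₂ _⊖_ (+-comm p n) (+-comm q n)) (ℤ.+-cancelˡ-⊖ n p q))
    (ℤ.⊖-monoˡ-≤ (q + n) (subst (_≤ p + n) (+-comm m q) le))

  private
    neg : ∀ v d → moveValue 0 (v ⊖ d) ≡ d ⊖ v
    neg v d = sym (ℤ.⊖-swap d v)

    minus : ∀ k v d → moveValue (suc k) (v ⊖ d) ≡ v ⊖ (suc k + d)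
    minus k v d = trans (ℤ.distribˡ-⊖-+-neg k v d) (cong (λ z → v ⊖ suc z) (+-comm d k))

  opaque
    unfolding score

    -- Without a capture the turn passes and the sign flips, which puts both values `v` and `v′` on
    -- the same side: the claim becomes an inequality in ℕ for their sum.
    quiet-lower : ∀ {v t p v′ t′ p′} → v + v′ ≤ (t′ + 2 * p′) + (t + 2 * p) →
                  score v t p ≤ᶻ moveValue 0 (score v′ t′ p′)
    quiet-lower {v} {t} {p} {v′} {t′} {p′} le =
      subst (v ⊖ (t + 2 * p) ≤ᶻ_) (sym (neg v′ (t′ + 2 * p′))) (⊖-mono {v} {t + 2 * p} {t′ + 2 * p′} le)

    quiet-upper : ∀ {v t p v′ t′ p′} → (t′ + 2 * p′) + (t + 2 * p) ≤ v + v′ →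
                  moveValue 0 (score v′ t′ p′) ≤ᶻ score v t p
    quiet-upper {v} {t} {p} {v′} {t′} {p′} le =
      subst (_≤ᶻ v ⊖ (t + 2 * p)) (sym (neg v′ (t′ + 2 * p′))) (⊖-mono {t′ + 2 * p′} {v′} {v} le)

    private
      regroup : ∀ k v t′ {p q} → p ≤ q → v + (suc k + (t′ + 2 * p)) ≤ v + (suc k + t′ + 2 * q)
      regroup k v t′ {p} {q} p≤q = +-monoʳ-≤ v (≤-trans (≤-reflexive (sym (+-assoc (suc k) t′ (2 * p))))
        (+-monoʳ-≤ (suc k + t′) (*-monoʳ-≤ 2 p≤q)))

      regroup′ : ∀ k v t′ {p q} → p ≤ q → v + (suc k + t′ + 2 * p) ≤ v + (suc k + (t′ + 2 * q))
      regroup′ k v t′ {p} {q} p≤q = +-monoʳ-≤ v (≤-trans (+-monoʳ-≤ (suc k + t′) (*-monoʳ-≤ 2 p≤q))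
        (≤-reflexive (+-assoc (suc k) t′ (2 * q))))

    -- Captures happen in opened paths, which do not enter `v`, and the captured boxes balance the
    -- drop of `t`. Only the penalties remain to be compared.
    capture-lower : ∀ k {v t t′ p p′} → t ≡ suc k + t′ → p′ ≤ p →
                    score v t p ≤ᶻ moveValue (suc k) (score v t′ p′)
    capture-lower k {v} {_} {t′} {p} {p′} refl p′≤p = subst (v ⊖ (suc k + t′ + 2 * p) ≤ᶻ_) (sym (minus k v (t′ + 2 * p′)))
      (⊖-mono {v} {suc k + t′ + 2 * p} {v} (regroup k v t′ p′≤p))

    capture-upper : ∀ k {v t t′ p p′} → t ≡ suc k + t′ → p ≤ p′ →
                    moveValue (suc k) (score v t′ p′) ≤ᶻ score v t p
    capture-upper k {v} {_} {t′} {p} {p′} refl p≤p′ = subst (_≤ᶻ v ⊖ (suc k + t′ + 2 * p)) (sym (minus k v (t′ + 2 * p′)))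
      (⊖-mono {v} {suc k + (t′ + 2 * p′)} {v} (regroup′ k v t′ p≤p′))

  NoExcess : List (Component n) → Set
  NoExcess Q = total chains Q ≡ 0 → total longs Q ≡ 0 → total excess Q ≡ 0

  no-excess : ∀ {Q : List (Component n)} → All Valid Q → NoExcess Q
  no-excess []                                     _  _  = refl
  no-excess (left {true} ∷ vs)                     nc nb = no-excess vs nc nb
  no-excess (left {false} ∷ vs)                    nc nb = no-excess vs nc nb
  no-excess (right {false} ∷ vs)                   nc nb = no-excess vs nc nb
  no-excess (right {true} ∷ vs)                    nc nb = no-excess vs nc nb
  no-excess (loop4 eq ∷ vs)   nc nb rewrite eq = no-excess vs nc nb
  no-excess (loop6 eq ∷ vs)   nc nb rewrite eq = no-excess vs nc nb
  no-excess (loop8 k eq ∷ vs) nc nb rewrite eq with () ← nb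

  -- Identifies the number of claimed boxes from the counting equation of a move, so that
  -- `moveValue` can reduce.
  balance : ∀ {k t t′} j → k + t′ ≡ t → t ≡ j + t′ → k ≡ j
  balance {k} {t} {t′} j eq eq′ = +-cancelʳ-≡ t′ k j (trans eq eq′)

  -- No move does better than the formula.

  private
    opening : ∀ {v v′ t p t′ p′} n q → v + v′ ≤ n + 2 * q → t′ ≡ n + t → q ≤ p′ →
              score v t p ≤ᶻ moveValue 0 (score v′ t′ p′)
    opening {v} {v′} {t} {p} {t′} {p′} n q le refl q≤ = quiet-lower {v} {t} {p} {v′} {t′} {p′} (begin
      v + v′                             ≤⟨ le ⟩
      n + 2 * q                          ≤⟨ +-mono-≤ (m≤m+n n t) (*-monoʳ-≤ 2 q≤) ⟩
      n + t + 2 * p′                     ≤⟨ m≤m+n _ _ ⟩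
      (n + t + 2 * p′) + (t + 2 * p)     ∎)
      where open ≤-Reasoning

    -- Cutting an open path without a capture hands at least j boxes over.
    splitting : ∀ j {v t p t′ p′} → t′ ≡ t → j ≤ t → v ∸ j ≤ p →
                score v t p ≤ᶻ moveValue 0 (score v t′ p′)
    splitting j {v} {t} {p} {t′} {p′} refl j≤t v∸j≤p = quiet-lower {v} {t} {p} {v} {t′} {p′} (begin
      v + v                              ≤⟨ +-mono-≤ v≤ v≤ ⟩
      (t + p) + (t + p)                  ≡⟨ lemma t p ⟩
      t + (t + 2 * p)                    ≤⟨ +-monoˡ-≤ (t + 2 * p) (m≤m+n t (2 * p′)) ⟩
      (t + 2 * p′) + (t + 2 * p)         ∎)
      where
      open ≤-Reasoning
      v≤ : v ≤ t + p
      v≤ = ≤-trans (m≤n+m∸n v j) (+-mono-≤ j≤t v∸j≤p)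
      lemma : ∀ t p → (t + p) + (t + p) ≡ t + (t + 2 * p)
      lemma = solve-∀

    -- Wherever a chain of at least 3 boxes is cut, one part keeps its end line and at least two
    -- boxes, so the opponent can keep control by giving up only two.
    ≥2-+ : ∀ x y {a} → 3 ≤ x + y → 1 ≤ ≥2 x + (≥2 y + a)
    ≥2-+ (suc (suc x)) y             _ = s≤s z≤n
    ≥2-+ zero          (suc (suc y)) _ = s≤s z≤n
    ≥2-+ (suc zero)    (suc (suc y)) _ = s≤s z≤n
    ≥2-+ zero          (suc zero)    (s≤s ())
    ≥2-+ (suc zero)    (suc zero)    (s≤s (s≤s ()))
    ≥2-+ (suc zero)    zero          (s≤s ())

  ≥4-cut : ∀ {x} → 4 ≤ x → 1 ≤ ≥4 x
  ≥4-cut (s≤s (s≤s (s≤s (s≤s _)))) = s≤s z≤n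

  length-rotate : ∀ (c : Fin n) xs ys → length (ys ++ c ∷ xs) ≡ length (c ∷ xs ++ ys)
  length-rotate c xs ys = trans (length-++ ys) (trans (+-comm (length ys) _) (cong suc (sym (length-++ xs))))

  touched-long : ∀ (bs : List (Fin n)) → 2 ≤ length bs → touched (path false false bs) ≡ length bs
  touched-long (b ∷ [])     (s≤s ())
  touched-long (_ ∷ _ ∷ _)  _ = refl

  touched-rotate : ∀ (c : Fin n) xs ys → 4 ≤ length (c ∷ xs ++ ys) →
                   touched (path false false (ys ++ c ∷ xs)) ≡ length (c ∷ xs ++ ys)
  touched-rotate c xs ys 4≤ = trans (touched-long (ys ++ c ∷ xs)
    (≤-trans (m≤m+n 2 2) (subst (4 ≤_) (sym (length-rotate c xs ys)) 4≤))) (length-rotate c xs ys)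

  module _ {Q : List (Component n)} (noExcess : NoExcess Q) where

    private
      v = closedValue Q
      f = total fours Q
      m = total sixes Q
      nc = total chains Q
      nb = total longs Q
      s = total excess Q
      t = total free Q
      a = total half Q
      b = total quad Q

    private
      lower-loop : ∀ c xs ys k → k + total touched (path false false (ys ++ c ∷ xs) ∷ []) ≡ length (c ∷ xs ++ ys) →
                   4 ≤ length (c ∷ xs ++ ys) →
                   closedValue (loop (c ∷ xs ++ ys) ∷ Q) + v ≤ length (c ∷ xs ++ ys) + 2 * (v ∸ 4) →
                   eval (loop (c ∷ xs ++ ys) ∷ Q) ≤ᶻ moveValue k (eval (path false false (ys ++ c ∷ xs) ∷ Q))
      lower-loop c xs ys k count 4≤ bound
        with refl ← balance {k} 0 count (sym (trans (+-identityʳ _) (touched-rotate c xs ys 4≤))) =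
        (opening (length (c ∷ xs ++ ys)) (v ∸ 4) bound
          (cong (_+ t) (touched-rotate c xs ys 4≤))
          (quad-penalty _ v (≤-trans (≥4-cut (subst (4 ≤_) (sym (length-rotate c xs ys)) 4≤)) (m≤m+n _ b))))

    -- Three kinds of cuts occur: opening a chain or loop is governed by the bounds on `closed`;
    -- cutting off a single box at an end without its line is a capture and cannot raise the
    -- penalty; every other cut of an opened path is a `splitting`.
    lower : ∀ {c : Component n} {cs} → Valid c → c ⟶ cs → ∀ k → k + total touched cs ≡ touched c →
            eval (c ∷ Q) ≤ᶻ moveValue k (eval (cs ++ Q))
    lower (chain j len) (cutPath {true} {true} xs ys _ _) k count
      with refl ← balance {k} 0 count (trans (length-++ xs) (cong (_+_ (length xs)) (sym (+-identityʳ _)))) =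
      (opening (length (xs ++ ys)) (v ∸ 2)
        (subst (λ z → closed f m (suc nc) nb (z ∸ 4 + s) + v ≤ z + 2 * (v ∸ 2)) (sym len) (closed-chain f m nc nb s noExcess j))
        (trans (sym (+-assoc (length xs) _ t)) (cong (_+ t) (sym (length-++ xs {ys}))))
        (half-penalty _ v (≥2-+ (length xs) (length ys) (≤-trans (m≤m+n 3 (suc j)) (≤-reflexive (trans (sym len) (length-++ xs)))))))
    lower (loop4 len) (cutLoop c xs ys) k count =
      lower-loop c xs ys k count (≤-reflexive (sym len))
        (subst (λ z → withLoop z Q + v ≤ z + 2 * (v ∸ 4)) (sym len)
          (closed-4loop f m nc nb s noExcess))
    lower (loop6 len) (cutLoop c xs ys) k count =
      lower-loop c xs ys k count (≤-trans (m≤m+n 4 2) (≤-reflexive (sym len)))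
        (subst (λ z → withLoop z Q + v ≤ z + 2 * (v ∸ 4)) (sym len)
          (closed-6loop f m nc nb s noExcess))
    lower (loop8 j len) (cutLoop c xs ys) k count =
      lower-loop c xs ys k count (≤-trans (m≤m+n 4 (4 + j)) (≤-reflexive (sym len)))
        (subst (λ z → withLoop z Q + v ≤ z + 2 * (v ∸ 4)) (sym len)
          (closed-loop f m nc nb s noExcess j))
    lower _ (cutPath {true} {false} xs [] _ ys≢) k count = contradiction (ys≢ refl) (λ ())
    lower _ (cutPath {true} {false} xs (y ∷ []) _ _) k count
      with refl ← balance {k} 1 count (trans (length-++ xs) (trans (+-comm _ 1) (cong suc (sym (+-identityʳ _))))) =
      capture-lower 0 (cong (_+ t) (trans (length-++ xs) (+-comm _ 1)))
        (penalty-mono v (+-monoˡ-≤ a (≥2-mono (≤-trans (m≤m+n (length xs) 1) (≤-reflexive (sym (length-++ xs)))))) ≤-refl)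
    lower _ (cutPath {true} {false} xs (y ∷ y′ ∷ ys) _ _) k count
      with refl ← balance {k} 0 count (trans (length-++ xs) (cong (_+_ (length xs)) (sym (+-identityʳ _)))) =
      (splitting 2 (trans (sym (+-assoc (length xs) _ t)) (cong (_+ t) (sym (length-++ xs))))
        (≤-trans 2≤ (m≤m+n _ t)) (half-penalty _ v (≤-trans (≥2-mono 2≤) (m≤m+n _ a))))
      where
      2≤ : 2 ≤ length (xs ++ y ∷ y′ ∷ ys)
      2≤ = ≤-trans (≤-trans (m≤m+n 2 _) (m≤n+m _ (length xs))) (≤-reflexive (sym (length-++ xs)))
    lower _ (cutPath {false} {true} [] ys xs≢ _) k count = contradiction (xs≢ refl) (λ ())
    lower _ (cutPath {false} {true} (x ∷ []) ys _ _) k count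
      with refl ← balance {k} 1 count (cong suc (sym (+-identityʳ _))) =
      capture-lower 0 refl (penalty-mono v (+-monoˡ-≤ a (≥2-mono (n≤1+n (length ys)))) ≤-refl)
    lower _ (cutPath {false} {true} (x ∷ x′ ∷ xs) ys _ _) k count
      with refl ← balance {k} 0 count (trans (length-++ (x ∷ x′ ∷ xs)) (cong (λ z → suc (suc (length xs + z))) (sym (+-identityʳ _)))) =
      (splitting 2 (cong (λ z → suc (suc z)) (trans (sym (+-assoc (length xs) _ t)) (cong (_+ t) (sym (length-++ xs)))))
        (m≤m+n 2 _) (half-penalty _ v (s≤s z≤n)))
    lower _ (cutPath {false} {false} [] ys xs≢ _) k count = contradiction (xs≢ refl) (λ ())
    lower _ (cutPath {false} {false} (x ∷ xs) [] _ ys≢) k count = contradiction (ys≢ refl) (λ ())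
    -- The only line borders both boxes, so one move claims two.
    lower _ (cutPath {false} {false} (x ∷ []) (y ∷ []) _ _) k count
      with refl ← balance {k} 2 count refl = capture-lower 1 refl ≤-refl
    lower _ (cutPath {false} {false} (x ∷ []) (y ∷ y′ ∷ ys) _ _) k count
      with refl ← balance {k} 1 count (cong (_+_ 3) (sym (+-identityʳ _))) =
      capture-lower 0 refl (penalty-mono v ≤-refl (+-monoˡ-≤ b (≥4-mono (n≤1+n (2 + length ys)))))
    lower _ (cutPath {false} {false} (x ∷ x′ ∷ xs) (y ∷ []) _ _) k count
      with refl ← balance {k} 1 count (cong (_+_ 2) (trans (length-++ xs) (trans (+-comm _ 1) (cong suc (sym (+-identityʳ _)))))) =
      capture-lower 0 (cong (λ z → 2 + z + t) (trans (length-++ xs) (+-comm _ 1)))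
        (penalty-mono v ≤-refl (+-monoˡ-≤ b (≥4-mono (s≤s (s≤s (≤-trans (m≤m+n (length xs) 1) (≤-reflexive (sym (length-++ xs)))))))))
    lower _ (cutPath {false} {false} (x ∷ x′ ∷ xs) (y ∷ y′ ∷ ys) _ _) k count
      with refl ← balance {k} 0 count (cong (_+_ 2) (trans (length-++ xs) (cong (_+_ (length xs)) (sym (+-identityʳ _))))) =
      (splitting 4 (cong (_+_ 2) (trans (sym (+-assoc (length xs) _ t)) (cong (_+ t) (sym (length-++ xs)))))
        (≤-trans 4≤ (m≤m+n _ t)) (quad-penalty _ v (≤-trans (≥4-mono 4≤) (m≤m+n _ b))))
      where
      4≤ : 4 ≤ 2 + length (xs ++ y ∷ y′ ∷ ys)
      4≤ = s≤s (s≤s (≤-trans (≤-trans (m≤m+n 2 _) (m≤n+m _ (length xs))) (≤-reflexive (sym (length-++ xs)))))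

  -- Some move attains the formula.

  record Capture (d : Component n) : Set where
    field
      rest      : List (Component n)
      k         : ℕ
      cut       : d ⟶ rest
      touched≡  : touched d ≡ suc k + total touched rest
      free≡     : ∀ Q → total free (d ∷ Q) ≡ suc k + total free (rest ++ Q)
      value≡    : ∀ Q → closedValue (rest ++ Q) ≡ closedValue (d ∷ Q)
      half≤     : ∀ Q → total half Q ≤ total half (rest ++ Q)
      quad≤     : ∀ Q → total quad Q ≤ total quad (rest ++ Q)
      -- With at least one box more than the handover needs, a capture still leaves the handover
      -- possible.
      long-half : 3 ≤ length (boxesOf d) → 1 ≤ half d → ∀ Q → 1 ≤ total half (rest ++ Q)
      long-quad : 5 ≤ length (boxesOf d) → 1 ≤ quad d → ∀ Q → 1 ≤ total quad (rest ++ Q)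

  ≥2-cut : ∀ {x} → 2 ≤ x → 1 ≤ ≥2 x
  ≥2-cut (s≤s (s≤s _)) = s≤s z≤n

  capture : ∀ (d : Component n) → 1 ≤ free d → Capture d
  capture (path true false bs) 1≤ with initLast bs
  capture (path true false _) () | []
  ... | xs ∷ʳ′ y = record
    { rest      = path true false xs ∷ path false false (y ∷ []) ∷ []
    ; k         = 0
    ; cut       = cutPath xs (y ∷ []) (λ _ → refl) (λ ())
    ; touched≡  = trans len (cong suc (sym (+-identityʳ _)))
    ; free≡     = λ Q → cong (_+ total free Q) len
    ; value≡    = λ _ → refl
    ; half≤     = λ Q → m≤n+m _ _
    ; quad≤     = λ Q → ≤-refl
    ; long-half = λ 3≤ _ Q → ≤-trans (≥2-cut (s≤s⁻¹ (subst (3 ≤_) len 3≤))) (m≤m+n _ _)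
    ; long-quad = λ _ ()
    }
    where
    len : length (xs ++ y ∷ []) ≡ suc (length xs)
    len = trans (length-++ xs) (+-comm (length xs) 1)
  capture (path false true (x ∷ ys)) 1≤ = record
    { rest      = path false false (x ∷ []) ∷ path false true ys ∷ []
    ; k         = 0
    ; cut       = cutPath (x ∷ []) ys (λ ()) (λ _ → refl)
    ; touched≡  = cong suc (sym (+-identityʳ _))
    ; free≡     = λ Q → refl
    ; value≡    = λ _ → refl
    ; half≤     = λ Q → m≤n+m _ _
    ; quad≤     = λ Q → ≤-refl
    ; long-half = λ 3≤ _ Q → ≤-trans (≥2-cut (s≤s⁻¹ 3≤)) (m≤m+n _ _)
    ; long-quad = λ _ ()
    }
  capture (path false false (x ∷ y ∷ [])) 1≤ = record
    { rest      = path false false (x ∷ []) ∷ path false false (y ∷ []) ∷ []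
    ; k         = 1
    ; cut       = cutPath (x ∷ []) (y ∷ []) (λ ()) (λ ())
    ; touched≡  = refl
    ; free≡     = λ Q → refl
    ; value≡    = λ _ → refl
    ; half≤     = λ Q → ≤-refl
    ; quad≤     = λ Q → ≤-refl
    ; long-half = λ _ ()
    ; long-quad = λ _ ()
    }
  capture (path false false (x ∷ y ∷ z ∷ zs)) 1≤ = record
    { rest      = path false false (x ∷ []) ∷ path false false (y ∷ z ∷ zs) ∷ []
    ; k         = 0
    ; cut       = cutPath (x ∷ []) (y ∷ z ∷ zs) (λ ()) (λ ())
    ; touched≡  = cong (_+_ 3) (sym (+-identityʳ _))
    ; free≡     = λ Q → refl
    ; value≡    = λ _ → refl
    ; half≤     = λ Q → ≤-refl
    ; quad≤     = λ Q → m≤n+m _ _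
    ; long-half = λ _ ()
    ; long-quad = λ 5≤ _ Q → ≤-trans (≥4-cut (s≤s⁻¹ 5≤)) (m≤m+n _ _)
    }

  Attained : List (Component n) → Set
  Attained P = ∃₂ λ c Q → ∃ λ cs → P ↭ c ∷ Q × c ⟶ cs ×
    (∀ k → k + total touched cs ≡ touched c → moveValue k (eval (cs ++ Q)) ≤ᶻ eval (c ∷ Q))

  attained-capture : ∀ {P : List (Component n)} {d Q} → P ↭ d ∷ Q → (C : Capture d) →
                     penaltyOf (d ∷ Q) ≤ penaltyOf (Capture.rest C ++ Q) → Attained P
  attained-capture {d = d} {Q} P↭ C p≤ = d , Q , rest , P↭ , cut , upper
    where
    open Capture C
    upper : ∀ j → j + total touched rest ≡ touched d → moveValue j (eval (rest ++ Q)) ≤ᶻ eval (d ∷ Q)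
    upper j count with refl ← balance {j} (suc k) count touched≡ =
      subst (λ w → moveValue (suc k) (score w _ (penaltyOf (rest ++ Q))) ≤ᶻ eval (d ∷ Q)) (sym (value≡ Q))
        (capture-upper k {closedValue (d ∷ Q)} {total free (d ∷ Q)} {total free (rest ++ Q)} (free≡ Q) p≤)

  pick : ∀ φ (P : List (Component n)) → total φ P ≡ 0 ⊎ ∃₂ λ c Q → P ↭ c ∷ Q × 1 ≤ φ c
  pick φ []      = inj₁ refl
  pick φ (c ∷ P) with φ c in eq
  ... | suc _ = inj₂ (c , P , ↭-refl , subst (1 ≤_) (sym eq) (s≤s z≤n))
  ... | zero with pick φ P
  ...   | inj₁ none               = inj₁ none
  ...   | inj₂ (d , Q , P↭ , 1≤) = inj₂ (d , c ∷ Q , ↭-trans (prep c P↭) (swap c d ↭-refl) , 1≤)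

  total-mono : ∀ {φ ψ : Component n → ℕ} → (∀ c → φ c ≤ ψ c) → ∀ P → total φ P ≤ total ψ P
  total-mono φ≤ []      = z≤n
  total-mono φ≤ (c ∷ P) = +-mono-≤ (φ≤ c) (total-mono φ≤ P)

  ≥2≤ : ∀ x → ≥2 x ≤ x
  ≥2≤ zero          = z≤n
  ≥2≤ (suc zero)    = z≤n
  ≥2≤ (suc (suc x)) = s≤s z≤n

  half≤free : ∀ (c : Component n) → half c ≤ free c
  half≤free (path true true bs)   = z≤n
  half≤free (path true false bs)  = ≥2≤ (length bs)
  half≤free (path false true bs)  = ≥2≤ (length bs)
  half≤free (path false false bs) = z≤n
  half≤free (loop bs)             = z≤n

  quad≤free : ∀ (c : Component n) → quad c ≤ free c
  quad≤free (path true true bs)                          = z≤n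
  quad≤free (path true false bs)                         = z≤n
  quad≤free (path false true bs)                         = z≤n
  quad≤free (path false false [])                        = z≤n
  quad≤free (path false false (_ ∷ []))                  = z≤n
  quad≤free (path false false (_ ∷ _ ∷ []))              = z≤n
  quad≤free (path false false (_ ∷ _ ∷ _ ∷ []))          = z≤n
  quad≤free (path false false (_ ∷ _ ∷ _ ∷ _ ∷ _))       = s≤s z≤n
  quad≤free (loop bs)                                    = z≤n

  -- The player to move gives the last j boxes away to keep control.
  handover : ∀ j {v t p t′ p′} → t ≡ j → t′ ≡ j → p ≡ v ∸ j → p′ ≡ 0 → j ≤ v →
             moveValue 0 (score v t′ p′) ≤ᶻ score v t p
  handover j {v} refl refl refl refl j≤v = quiet-upper {v} {j} {v ∸ j} {v} {j} {0} (≤-reflexive (begin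
    (j + 0) + (j + 2 * (v ∸ j))      ≡⟨ lemma j (v ∸ j) ⟩
    (v ∸ j + j) + (v ∸ j + j)        ≡⟨ cong₂ _+_ (m∸n+n≡m j≤v) (m∸n+n≡m j≤v) ⟩
    v + v                            ∎))
    where
    open ≡-Reasoning
    lemma : ∀ j d → (j + 0) + (j + 2 * d) ≡ (d + j) + (d + j)
    lemma = solve-∀

  penaltyOf-none : ∀ (P : List (Component n)) → total half P ≡ 0 → total quad P ≡ 0 → penaltyOf P ≡ 0
  penaltyOf-none P h q = trans (cong₂ (λ a b → penalty a b (closedValue P)) h q) (penalty-none (closedValue P))

  penaltyOf-half : ∀ (P : List (Component n)) → 1 ≤ total half P → penaltyOf P ≡ closedValue P ∸ 2
  penaltyOf-half P 1≤ = penalty-half (total half P) 1≤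

  penaltyOf-quad : ∀ (P : List (Component n)) → total half P ≡ 0 → 1 ≤ total quad P → penaltyOf P ≡ closedValue P ∸ 4
  penaltyOf-quad P h 1≤ = trans (cong (λ a → penalty a (total quad P) (closedValue P)) h) (penalty-quad (total quad P) 1≤)

  module _ {P : List (Component n)} {c Q} (P↭ : P ↭ c ∷ Q) where

    private
      front : ∀ {d Q′} → Q ↭ d ∷ Q′ → P ↭ d ∷ c ∷ Q′
      front Q↭ = ↭-trans P↭ (↭-trans (prep c Q↭) (swap c _ ↭-refl))

    -- As long as another component offers a box, taking it is safe, because `c` still permits the
    -- handover. Once only `c` is left, a rest worth at most 2 makes control worthless and a box is
    -- taken; with three or more boxes one is taken as well; with exactly two the handover is due.
    attained-half : 1 ≤ half c → Attained P
    attained-half 1≤ with pick free Q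
    ... | inj₂ (d , Q′ , Q↭ , 1≤free) = attained-capture (front Q↭) C (begin
      penaltyOf (d ∷ c ∷ Q′)                       ≡⟨ penaltyOf-half (d ∷ c ∷ Q′) (≤-trans kept (m≤n+m _ (half d))) ⟩
      closedValue (d ∷ c ∷ Q′) ∸ 2                 ≡⟨ cong (_∸ 2) (sym (value≡ (c ∷ Q′))) ⟩
      closedValue (rest ++ c ∷ Q′) ∸ 2             ≡⟨ sym (penaltyOf-half (rest ++ c ∷ Q′) (≤-trans kept (half≤ (c ∷ Q′)))) ⟩
      penaltyOf (rest ++ c ∷ Q′)                   ∎)
      where
      open ≤-Reasoning
      C = capture d 1≤free
      open Capture C
      kept : 1 ≤ total half (c ∷ Q′)
      kept = ≤-trans 1≤ (m≤m+n (half c) _)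
    ... | inj₁ free≡0 with ≤-total (closedValue (c ∷ Q)) 2
    ... | inj₁ v≤2 = attained-capture P↭ (capture c (≤-trans 1≤ (half≤free c)))
      (≤-trans (≤-reflexive (trans (penaltyOf-half (c ∷ Q) (≤-trans 1≤ (m≤m+n (half c) _))) (m≤n⇒m∸n≡0 v≤2))) z≤n)
    ... | inj₂ 2≤v with 3 ≤? length (boxesOf c)
    ... | yes 3≤ = attained-capture P↭ C (≤-reflexive (begin
      penaltyOf (c ∷ Q)            ≡⟨ penaltyOf-half (c ∷ Q) (≤-trans 1≤ (m≤m+n (half c) _)) ⟩
      closedValue (c ∷ Q) ∸ 2      ≡⟨ cong (_∸ 2) (sym (value≡ Q)) ⟩
      closedValue (rest ++ Q) ∸ 2  ≡⟨ sym (penaltyOf-half (rest ++ Q) (long-half 3≤ 1≤ Q)) ⟩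
      penaltyOf (rest ++ Q)        ∎))
      where
      open ≡-Reasoning
      C = capture c (≤-trans 1≤ (half≤free c))
      open Capture C
    ... | no 3≰ = short-half c P↭ 1≤ 3≰ 2≤v
      where
      half≡0 : total half Q ≡ 0
      half≡0 = n≤0⇒n≡0 (subst (total half Q ≤_) free≡0 (total-mono half≤free Q))
      quad≡0 : total quad Q ≡ 0
      quad≡0 = n≤0⇒n≡0 (subst (total quad Q ≤_) free≡0 (total-mono quad≤free Q))
      short-half : ∀ c → P ↭ c ∷ Q → 1 ≤ half c → ¬ (3 ≤ length (boxesOf c)) → 2 ≤ closedValue (c ∷ Q) → Attained P
      -- Drawing the end line leaves the two boxes around one common line: the opponent takes both
      -- at once and still has to move.
      short-half (path true false (x ∷ y ∷ []))    P↭ 1≤ _ 2≤v = _ , Q , _ , P↭ ,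
        cutPath [] (x ∷ y ∷ []) (λ _ → refl) (λ ()) , upper
        where
        upper : ∀ k → k + 2 ≡ 2 → moveValue k (eval (path true false [] ∷ path false false (x ∷ y ∷ []) ∷ Q)) ≤ᶻ
                                   eval (path true false (x ∷ y ∷ []) ∷ Q)
        upper k count with refl ← balance {k} 0 count refl = handover 2 (cong (_+_ 2) free≡0) (cong (_+_ 2) free≡0)
          (penaltyOf-half (path true false (x ∷ y ∷ []) ∷ Q) (s≤s z≤n))
          (penaltyOf-none (path true false [] ∷ path false false (x ∷ y ∷ []) ∷ Q) half≡0 quad≡0) 2≤v
      short-half (path false true (x ∷ y ∷ []))    P↭ 1≤ _ 2≤v = _ , Q , _ , P↭ ,
        cutPath (x ∷ y ∷ []) [] (λ ()) (λ _ → refl) , upper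
        where
        upper : ∀ k → k + 2 ≡ 2 → moveValue k (eval (path false false (x ∷ y ∷ []) ∷ path false true [] ∷ Q)) ≤ᶻ
                                   eval (path false true (x ∷ y ∷ []) ∷ Q)
        upper k count with refl ← balance {k} 0 count refl = handover 2 (cong (_+_ 2) free≡0) (cong (_+_ 2) free≡0)
          (penaltyOf-half (path false true (x ∷ y ∷ []) ∷ Q) (s≤s z≤n))
          (penaltyOf-none (path false false (x ∷ y ∷ []) ∷ path false true [] ∷ Q) half≡0 quad≡0) 2≤v
      short-half (path true false (_ ∷ _ ∷ _ ∷ _)) P↭ 1≤ 3≰ _ = contradiction (s≤s (s≤s (s≤s z≤n))) 3≰
      short-half (path false true (_ ∷ _ ∷ _ ∷ _)) P↭ 1≤ 3≰ _ = contradiction (s≤s (s≤s (s≤s z≤n))) 3≰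

    attained-quad : total half P ≡ 0 → 1 ≤ quad c → Attained P
    attained-quad noHalf 1≤ with pick free Q
    ... | inj₂ (d , Q′ , Q↭ , 1≤free) = attained-capture (front Q↭) C (begin
      penaltyOf (d ∷ c ∷ Q′)                       ≡⟨ penaltyOf-quad (d ∷ c ∷ Q′) (trans (sym (total-↭ half (front Q↭))) noHalf)
                                                        (≤-trans kept (m≤n+m _ (quad d))) ⟩
      closedValue (d ∷ c ∷ Q′) ∸ 4                 ≡⟨ cong (_∸ 4) (sym (value≡ (c ∷ Q′))) ⟩
      closedValue (rest ++ c ∷ Q′) ∸ 4             ≤⟨ quad-penalty _ _ (≤-trans kept (quad≤ (c ∷ Q′))) ⟩
      penaltyOf (rest ++ c ∷ Q′)                   ∎)
      where
      open ≤-Reasoning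
      C = capture d 1≤free
      open Capture C
      kept : 1 ≤ total quad (c ∷ Q′)
      kept = ≤-trans 1≤ (m≤m+n (quad c) _)
    ... | inj₁ free≡0 with ≤-total (closedValue (c ∷ Q)) 4
    ... | inj₁ v≤4 = attained-capture P↭ (capture c (≤-trans 1≤ (quad≤free c)))
      (≤-trans (≤-reflexive (trans
        (penaltyOf-quad (c ∷ Q) (trans (sym (total-↭ half P↭)) noHalf) (≤-trans 1≤ (m≤m+n (quad c) _))) (m≤n⇒m∸n≡0 v≤4))) z≤n)
    ... | inj₂ 4≤v with 5 ≤? length (boxesOf c)
    ... | yes 5≤ = attained-capture P↭ C (begin
      penaltyOf (c ∷ Q)            ≡⟨ penaltyOf-quad (c ∷ Q) (trans (sym (total-↭ half P↭)) noHalf) (≤-trans 1≤ (m≤m+n (quad c) _)) ⟩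
      closedValue (c ∷ Q) ∸ 4      ≡⟨ cong (_∸ 4) (sym (value≡ Q)) ⟩
      closedValue (rest ++ Q) ∸ 4  ≤⟨ quad-penalty _ _ (long-quad 5≤ 1≤ Q) ⟩
      penaltyOf (rest ++ Q)        ∎)
      where
      open ≤-Reasoning
      C = capture c (≤-trans 1≤ (quad≤free c))
      open Capture C
    ... | no 5≰ = short-quad c P↭ 1≤ 5≰ 4≤v
      where
      half≡0 : total half Q ≡ 0
      half≡0 = n≤0⇒n≡0 (subst (total half Q ≤_) free≡0 (total-mono half≤free Q))
      quad≡0 : total quad Q ≡ 0
      quad≡0 = n≤0⇒n≡0 (subst (total quad Q ≤_) free≡0 (total-mono quad≤free Q))
      short-quad : ∀ c → P ↭ c ∷ Q → 1 ≤ quad c → ¬ (5 ≤ length (boxesOf c)) → 4 ≤ closedValue (c ∷ Q) → Attained P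
      -- The middle line splits the four boxes into two pairs, each around a single line; all four
      -- go to the opponent, who must then open.
      short-quad (path false false (w ∷ x ∷ y ∷ z ∷ [])) P↭ 1≤ _ 4≤v = _ , Q , _ , P↭ ,
        cutPath (w ∷ x ∷ []) (y ∷ z ∷ []) (λ ()) (λ ()) , upper
        where
        upper : ∀ k → k + 4 ≡ 4 → moveValue k (eval (path false false (w ∷ x ∷ []) ∷ path false false (y ∷ z ∷ []) ∷ Q)) ≤ᶻ
                                   eval (path false false (w ∷ x ∷ y ∷ z ∷ []) ∷ Q)
        upper k count with refl ← balance {k} 0 count refl = handover 4 (cong (_+_ 4) free≡0) (cong (_+_ 4) free≡0)
          (penaltyOf-quad (path false false (w ∷ x ∷ y ∷ z ∷ []) ∷ Q) half≡0 (s≤s z≤n))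
          (penaltyOf-none (path false false (w ∷ x ∷ []) ∷ path false false (y ∷ z ∷ []) ∷ Q) half≡0 quad≡0) 4≤v
      short-quad (path false false (_ ∷ _ ∷ _ ∷ _ ∷ _ ∷ _)) P↭ 1≤ 5≰ _ = contradiction (s≤s (s≤s (s≤s (s≤s (s≤s z≤n))))) 5≰

  attained-free : ∀ {P : List (Component n)} {c Q} → P ↭ c ∷ Q → total half P ≡ 0 → total quad P ≡ 0 → 1 ≤ free c → Attained P
  attained-free {c = c} {Q} P↭ noHalf noQuad 1≤ = attained-capture P↭ (capture c 1≤)
    (≤-trans (≤-reflexive (penaltyOf-none (c ∷ Q) (trans (sym (total-↭ half P↭)) noHalf) (trans (sym (total-↭ quad P↭)) noQuad))) z≤n)

  record Dead (P : List (Component n)) : Set where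
    constructor dead
    field
      no-fours  : total fours P ≡ 0
      no-sixes  : total sixes P ≡ 0
      no-longs  : total longs P ≡ 0
      no-chains : total chains P ≡ 0
      no-free   : total free P ≡ 0

  opening-upper : ∀ {v v′ t p t′ p′} n q → n + 2 * q ≤ v + v′ → t ≡ 0 → p ≡ 0 → t′ ≡ n → p′ ≡ q →
                  moveValue 0 (score v′ t′ p′) ≤ᶻ score v t p
  opening-upper {v} {v′} n q le refl refl refl refl = quiet-upper {v} {0} {0} {v′} {n} {q}
    (subst (_≤ v + v′) (sym (+-identityʳ _)) le)

  private
    rest-none : ∀ φ {P : List (Component n)} {c Q} → P ↭ c ∷ Q → total φ P ≡ 0 → total φ Q ≡ 0
    rest-none φ {c = c} {Q} P↭ none = m+n≡0⇒n≡0 (φ c) (trans (sym (total-↭ φ P↭)) none)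

  module _ {P : List (Component n)} (noHalf : total half P ≡ 0) (noQuad : total quad P ≡ 0) (noFree : total free P ≡ 0) where

    private
      none : ∀ {c Q} → P ↭ c ∷ Q → penaltyOf (c ∷ Q) ≡ 0
      none {c} {Q} P↭ = penaltyOf-none (c ∷ Q) (trans (sym (total-↭ half P↭)) noHalf) (trans (sym (total-↭ quad P↭)) noQuad)

    attained-loop : ∀ {bs Q} → P ↭ loop bs ∷ Q → 4 ≤ length bs →
                    length bs + 2 * (closedValue Q ∸ 4) ≤ closedValue (loop bs ∷ Q) + closedValue Q → Attained P
    attained-loop {b ∷ ys} {Q} P↭ 4≤ bound = loop (b ∷ ys) , Q , _ , P↭ , cutLoop b [] ys , upper
      where
      upper : ∀ k → k + (touched (path false false (ys ++ b ∷ [])) + 0) ≡ suc (length ys) →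
              moveValue k (eval (path false false (ys ++ b ∷ []) ∷ Q)) ≤ᶻ eval (loop (b ∷ ys) ∷ Q)
      upper k count with refl ← balance {k} 0 count (sym (trans (+-identityʳ _) (touched-rotate b [] ys 4≤))) =
        opening-upper (length (b ∷ ys)) (closedValue Q ∸ 4) bound (trans (sym (total-↭ free P↭)) noFree) (none P↭)
          (trans (cong₂ _+_ (touched-rotate b [] ys 4≤) (rest-none free P↭ noFree)) (+-identityʳ _))
          (penaltyOf-quad (path false false (ys ++ b ∷ []) ∷ Q) (rest-none half P↭ noHalf)
            (≤-trans (≥4-cut (subst (4 ≤_) (sym (length-rotate b [] ys)) 4≤)) (m≤m+n _ _)))

    attained-chain : ∀ {bs Q} → P ↭ path true true bs ∷ Q → 4 ≤ length bs →
                     length bs + 2 * (closedValue Q ∸ 2) ≤ closedValue (path true true bs ∷ Q) + closedValue Q → Attained P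
    attained-chain {bs} {Q} P↭ 4≤ bound = path true true bs , Q , _ , P↭ , cutPath [] bs (λ _ → refl) (λ _ → refl) , upper
      where
      upper : ∀ k → k + (length bs + 0) ≡ length bs →
              moveValue k (eval (path true false [] ∷ path false true bs ∷ Q)) ≤ᶻ eval (path true true bs ∷ Q)
      upper k count with refl ← balance {k} 0 count (sym (+-identityʳ _)) =
        opening-upper (length bs) (closedValue Q ∸ 2) bound (trans (sym (total-↭ free P↭)) noFree) (none P↭)
          (trans (cong (_+_ (length bs)) (rest-none free P↭ noFree)) (+-identityʳ _))
          (penaltyOf-half (path true false [] ∷ path false true bs ∷ Q) (≤-trans (≥2-cut (≤-trans (m≤m+n 2 2) 4≤)) (m≤m+n _ _)))

    -- The order of the searches is forced by the equality cases of `closed`: each of them assumes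
    -- that the kinds of components tried earlier are absent.
    loony⊎dead : All Valid P → Attained P ⊎ Dead P
    loony⊎dead valid with pick fours P
    ... | inj₂ (c , Q , P↭ , 1≤) = inj₁ (open-four (All.head (All-resp-↭ P↭ valid)) P↭ 1≤)
      where
      open-four : ∀ {c} → Valid c → P ↭ c ∷ Q → 1 ≤ fours c → Attained P
      open-four (left {true})  P↭ ()
      open-four (left {false}) P↭ ()
      open-four (right {true}) P↭ ()
      open-four (right {false}) P↭ ()
      open-four (loop6 len) P↭ 1≤ rewrite len with () ← 1≤
      open-four (loop8 k len) P↭ 1≤ rewrite len with () ← 1≤
      open-four (loop4 {bs} len) P↭ 1≤ = attained-loop P↭ (≤-reflexive (sym len))
        (subst (λ z → z + 2 * (closedValue Q ∸ 4) ≤ withLoop z Q + closedValue Q)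
          (sym len) (closed-4loop-tight _ _ _ _ _))
    ... | inj₁ fours≡0 with pick sixes P
    ... | inj₂ (c , Q , P↭ , 1≤) = inj₁ (open-six (All.head (All-resp-↭ P↭ valid)) P↭ 1≤)
      where
      open-six : ∀ {c} → Valid c → P ↭ c ∷ Q → 1 ≤ sixes c → Attained P
      open-six (left {true})  P↭ ()
      open-six (left {false}) P↭ ()
      open-six (right {true}) P↭ ()
      open-six (right {false}) P↭ ()
      open-six (loop4 len) P↭ 1≤ rewrite len with () ← 1≤
      open-six (loop8 k len) P↭ 1≤ rewrite len with () ← 1≤
      open-six (loop6 {bs} len) P↭ 1≤ = attained-loop P↭ (≤-trans (m≤m+n 4 2) (≤-reflexive (sym len)))
        (subst (λ z → z + 2 * (closedValue Q ∸ 4) ≤ withLoop z Q + closedValue Q)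
          (sym len) bound)
        where
        bound : 6 + 2 * (closedValue Q ∸ 4) ≤
                closed (total fours Q) (suc (total sixes Q)) (total chains Q) (total longs Q) (total excess Q) + closedValue Q
        bound rewrite rest-none fours P↭ fours≡0 = closed-6loop-tight (total sixes Q) (total chains Q) (total longs Q) (total excess Q)
    ... | inj₁ sixes≡0 with pick longs P
    ... | inj₂ (c , Q , P↭ , 1≤) = inj₁ (open-long (All.head (All-resp-↭ P↭ valid)) P↭ 1≤)
      where
      open-long : ∀ {c} → Valid c → P ↭ c ∷ Q → 1 ≤ longs c → Attained P
      open-long (left {true})  P↭ ()
      open-long (left {false}) P↭ ()
      open-long (right {true}) P↭ ()
      open-long (right {false}) P↭ ()
      open-long (loop4 len) P↭ 1≤ rewrite len with () ← 1≤
      open-long (loop6 len) P↭ 1≤ rewrite len with () ← 1≤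
      open-long (loop8 k {bs} len) P↭ 1≤ = attained-loop P↭ (≤-trans (m≤m+n 4 (4 + k)) (≤-reflexive (sym len)))
        (subst (λ z → z + 2 * (closedValue Q ∸ 4) ≤ withLoop z Q + closedValue Q)
          (sym len) bound)
        where
        bound : 8 + k + 2 * (closedValue Q ∸ 4) ≤
                closed (total fours Q) (total sixes Q) (total chains Q) (suc (total longs Q)) (k + total excess Q) + closedValue Q
        bound rewrite rest-none fours P↭ fours≡0 | rest-none sixes P↭ sixes≡0 =
          closed-loop-tight (total chains Q) (total longs Q) (total excess Q) (no-excess (All.tail (All-resp-↭ P↭ valid))) k
    ... | inj₁ longs≡0 with pick chains P
    ... | inj₂ (c , Q , P↭ , 1≤) = inj₁ (open-chain (All.head (All-resp-↭ P↭ valid)) P↭ 1≤)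
      where
      open-chain : ∀ {c} → Valid c → P ↭ c ∷ Q → 1 ≤ chains c → Attained P
      open-chain (left {true})  P↭ ()
      open-chain (left {false}) P↭ ()
      open-chain (right {true}) P↭ ()
      open-chain (right {false}) P↭ ()
      open-chain (chain k {bs} len) P↭ 1≤ = attained-chain P↭ (≤-trans (m≤m+n 4 k) (≤-reflexive (sym len)))
        (subst (λ z → z + 2 * (closedValue Q ∸ 2) ≤
                closed (total fours Q) (total sixes Q) (suc (total chains Q)) (total longs Q) (z ∸ 4 + total excess Q) + closedValue Q)
          (sym len) bound)
        where
        noLongs = rest-none longs P↭ longs≡0
        bound : 4 + k + 2 * (closedValue Q ∸ 2) ≤
                closed (total fours Q) (total sixes Q) (suc (total chains Q)) (total longs Q) (k + total excess Q) + closedValue Q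
        bound rewrite rest-none fours P↭ fours≡0 | rest-none sixes P↭ sixes≡0 | noLongs =
          closed-chain-tight (total chains Q) (total excess Q) (λ nc → no-excess (All.tail (All-resp-↭ P↭ valid)) nc noLongs) k
    ... | inj₁ chains≡0 = inj₂ (dead fours≡0 sixes≡0 longs≡0 chains≡0 noFree)

  -- The first searches follow the clauses of `penalty`, and a closed component is opened only when
  -- nothing can be captured.
  attained⊎dead : ∀ {P : List (Component n)} → All Valid P → Attained P ⊎ Dead P
  attained⊎dead {P = P} valid with pick half P
  ... | inj₂ (c , Q , P↭ , 1≤) = inj₁ (attained-half P↭ 1≤)
  ... | inj₁ noHalf with pick quad P
  ... | inj₂ (c , Q , P↭ , 1≤) = inj₁ (attained-quad P↭ noHalf 1≤)
  ... | inj₁ noQuad with pick free P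
  ... | inj₂ (c , Q , P↭ , 1≤) = inj₁ (attained-free P↭ noHalf noQuad 1≤)
  ... | inj₁ noFree = loony⊎dead noHalf noQuad noFree valid

  dead-eval : ∀ {P : List (Component n)} → Dead P → eval P ≡ 0ℤ
  dead-eval {P = P} (dead f m nb nc t) = begin
    score (closedValue P) (total free P) (penaltyOf P) ≡⟨ cong₂ (λ v t → score v t (penalty (total half P) (total quad P) v)) v≡0 t ⟩
    score 0 0 (penalty (total half P) (total quad P) 0) ≡⟨ cong (score 0 0) (penalty-zero (total half P) (total quad P)) ⟩
    score 0 0 0                                        ≡⟨ score-def 0 ⟩
    0ℤ                                                 ∎
    where
    open ≡-Reasoning
    v≡0 : closedValue P ≡ 0
    v≡0 rewrite f | m | nb | nc = closed-empty (total excess P)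

  dead-lines : ∀ {P : List (Component n)} → All Valid P → Dead P → concatMap linesOf P ≡ []
  dead-lines [] _ = refl
  dead-lines {P = c ∷ P} (valid ∷ valids) (dead f m nb nc t) = cong₂ _++_
    (go c valid (m+n≡0⇒m≡0 (fours c) f) (m+n≡0⇒m≡0 (sixes c) m) (m+n≡0⇒m≡0 (longs c) nb) (m+n≡0⇒m≡0 (chains c) nc) (m+n≡0⇒m≡0 (free c) t))
    (dead-lines valids (dead (m+n≡0⇒n≡0 (fours c) f) (m+n≡0⇒n≡0 (sixes c) m) (m+n≡0⇒n≡0 (longs c) nb) (m+n≡0⇒n≡0 (chains c) nc) (m+n≡0⇒n≡0 (free c) t)))
    where
    go : ∀ {n} (c : Component n) → Valid c → fours c ≡ 0 → sixes c ≡ 0 → longs c ≡ 0 → chains c ≡ 0 → free c ≡ 0 → linesOf c ≡ []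
    go (path true true bs)             _ f m nb () t
    go (path true false [])            _ f m nb nc t = refl
    go (path false true [])            _ f m nb nc t = refl
    go (path false false [])           _ f m nb nc t = refl
    go (path false false (_ ∷ []))     _ f m nb nc t = refl
    go (path true false (_ ∷ _))       _ f m nb nc ()
    go (path false true (_ ∷ _))       _ f m nb nc ()
    go (path false false (_ ∷ _ ∷ _))  _ f m nb nc ()
    go (loop bs) (loop4 len)   f m nb nc t rewrite len with () ← f
    go (loop bs) (loop6 len)   f m nb nc t rewrite len with () ← m
    go (loop bs) (loop8 k len) f m nb nc t rewrite len with () ← nb

  -- The formula is the value of the game.

  eval-↭ : ∀ {P Q : List (Component n)} → P ↭ Q → eval P ≡ eval Q
  eval-↭ σ rewrite total-↭ fours σ | total-↭ sixes σ | total-↭ chains σ | total-↭ longs σ | total-↭ excess σ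
                 | total-↭ free σ | total-↭ half σ | total-↭ quad σ = refl

  cut-valid : ∀ {c : Component n} {cs} → c ⟶ cs → All Valid cs
  cut-valid (cutPath xs ys _ _) = left ∷ right ∷ []
  cut-valid (cutLoop b xs ys)   = left ∷ []

  private
    foldr-⊓-≤ : ∀ {m} z (f : Fin m → ℤ) → Functional.foldr _⊓_ z f ≤ᶻ z × (∀ i → Functional.foldr _⊓_ z f ≤ᶻ f i)
    foldr-⊓-≤ {zero}  z f = ℤ.≤-refl , λ ()
    foldr-⊓-≤ {suc m} z f with foldr-⊓-≤ z (λ i → f (suc i))
    ... | ≤z , ≤f = ℤ.≤-trans (ℤ.i⊓j≤j (f zero) _) ≤z , λ where
      zero    → ℤ.i⊓j≤i (f zero) _
      (suc i) → ℤ.≤-trans (ℤ.i⊓j≤j (f zero) _) (≤f i)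

    foldr-⊓-glb : ∀ {m} x z (f : Fin m → ℤ) → x ≤ᶻ z → (∀ i → x ≤ᶻ f i) → x ≤ᶻ Functional.foldr _⊓_ z f
    foldr-⊓-glb {zero}  x z f x≤z x≤f = x≤z
    foldr-⊓-glb {suc m} x z f x≤z x≤f = ℤ.⊓-glb (x≤f zero) (foldr-⊓-glb x z (λ i → f (suc i)) x≤z (λ i → x≤f (suc i)))

  minimum≡ : ∀ {m} (f : Fin (suc m) → ℤ) x → (∀ i → x ≤ᶻ f i) → ∃ (λ i → f i ≤ᶻ x) → minimum f ≡ x
  minimum≡ f x x≤ (i , fi≤x) = ℤ.≤-antisym (ℤ.≤-trans (minimum≤ i) fi≤x)
    (foldr-⊓-glb x (f zero) (λ i → f (suc i)) (x≤ zero) (λ i → x≤ (suc i)))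
    where
    minimum≤ : ∀ i → minimum f ≤ᶻ f i
    minimum≤ zero    = proj₁ (foldr-⊓-≤ (f zero) (λ i → f (suc i)))
    minimum≤ (suc i) = proj₂ (foldr-⊓-≤ (f zero) (λ i → f (suc i))) i

  -- Induction on the number of lines: cuts preserve validity, `lower` bounds every move, and an
  -- attaining cut supplies a move that reaches the bound. Without lines there is no cut, so the
  -- position is dead and its formula is 0.
  value≡eval : ∀ {m} (ls : Vec (Line n) m) {P} → Realises (toList ls) P → All Valid P → value ls ≡ eval P
  value≡eval {m = zero} [] {P} r valid with attained⊎dead valid
  ... | inj₂ isDead = sym (dead-eval isDead)
  ... | inj₁ (c , Q , cs , P↭ , cut , _) with cut-line cut
  ... | e , c-lines = contradiction (↭-sym (↭-trans (Realises.lines-↭ r)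
    (↭-trans (concatMap-↭ linesOf P↭) (↭-++⁺ʳ (concatMap linesOf Q) c-lines)))) ¬x∷xs↭[]
  value≡eval {n} {m = suc m} ls {P} r valid = minimum≡ _ (eval P) lower-bound attained
    where
    after : ∀ {c Q cs i} → P ↭ c ∷ Q → Draw ls c Q cs i → value (removeAt ls i) ≡ eval (cs ++ Q)
    after {i = i} P↭ (draw cut r′ _) = value≡eval (removeAt ls i) r′
      (All.++⁺ (cut-valid cut) (All.tail (All-resp-↭ P↭ valid)))

    score-of : Fin (suc m) → ℤ
    score-of i = moveValue (claimed (lookup ls i) (removeAt ls i)) (value (removeAt ls i))

    lower-bound : ∀ i → eval P ≤ᶻ score-of i
    lower-bound i with draw-cuts ls r (λ c∈ → non-degenerate (All.lookup valid c∈)) i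
      where
      non-degenerate : ∀ {c} → Valid c → c ≢ path true true []
      non-degenerate (chain k ()) refl
    ... | c , Q , P↭ , cs , d@(draw cut r′ count) = subst₂ _≤ᶻ_ (sym (eval-↭ P↭)) (cong (moveValue k) (sym (after P↭ d)))
      (lower (no-excess (All.tail (All-resp-↭ P↭ valid))) (All.head (All-resp-↭ P↭ valid)) cut k count)
      where
      k = claimed (lookup ls i) (removeAt ls i)

    attained : ∃ λ i → score-of i ≤ᶻ eval P
    attained with attained⊎dead valid
    ... | inj₂ isDead = contradiction (↭-trans (↭-sym (lookup-removeAt-↭ ls zero))
      (subst (toList ls ↭_) (dead-lines valid isDead) (Realises.lines-↭ r))) ¬x∷xs↭[]
    ... | inj₁ (c , Q , cs , P↭ , cut , upper) with cut-draws ls r P↭ cut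
    ... | i , d = i , subst₂ _≤ᶻ_ (cong (moveValue k) (sym (after P↭ d))) (sym (eval-↭ P↭)) (upper k (Draw.count d))
      where
      k = claimed (lookup ls i) (removeAt ls i)

open import Defs
open import Data.Nat using () renaming (_≥_ to _≥ⁿ_)
import Data.Nat.Divisibility as ℕ
open import Data.Integer using (ℤ; +_; _-_; ∣_∣; _≤_; _≥_)
open import Data.Integer.Divisibility using (_∣_)
open import Data.Product using (_×_)
open import Data.Sum using (_⊎_)
open import Relation.Binary.PropositionalEquality using (_≡_)
open import Relation.Nullary using (¬_)
open import Data.Bool using (true; false)
open import Data.Fin using (Fin)
open import Data.Fin.Subset using (Subset; ⊥; ⁅_⁆; _∪_)
open import Data.Integer as ℤ using (_⊖_)
import Data.Integer.Properties as ℤ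
open import Data.List using (List; []; _∷_; [_]; _++_; _∷ʳ_; map; zipWith; filter; concat; concatMap; length)
open import Data.List.Properties
  using (map-++; map-∘; map-id; map-cong; concatMap-++; concatMap-map; concatMap-cong; filter-accept; filter-reject)
open import Data.List.Relation.Binary.Permutation.Propositional using (↭-trans; ↭-reflexive)
open import Data.List.Relation.Unary.All as All using (All; []; _∷_)
import Data.List.Relation.Unary.All.Properties as All
open import Data.List.Relation.Unary.Any using (any?; here)
open import Data.List.Relation.Unary.Unique.Propositional using (Unique)
open import Data.Nat as ℕ using (ℕ; zero; suc; z≤n; s≤s; _∸_) renaming (_≤_ to _≤ⁿ_; _+_ to _+ⁿ_; _*_ to _*ⁿ_)
open import Data.Nat.GeneralisedArithmetic using (fold)
open import Data.Nat.ListAction using (sum)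
import Data.Nat.Properties as ℕ
open import Data.Nat.Tactic.RingSolver using (solve-∀)
open import Data.Product using (_,_; ∃)
open import Data.Sum using (inj₁; inj₂)
open import Data.Vec using (fromList)
open import Data.Vec.Properties using (toList∘fromList)
open import Function using (_∘_)
open import Relation.Binary.PropositionalEquality
  using (_≢_; refl; sym; trans; cong; cong₂; subst; module ≡-Reasoning)
open import Relation.Nullary using (yes; no; contradiction)
open import Relation.Nullary.Decidable using (¬?; dec-true; from-no)
open Values
open Positions
open Evaluation hiding (chains)
open SimpleLoonyEndgame using (game)

private variable
  n : ℕ

-- From a given endgame to components, counts and controlled value.

joins≡zipWith : ∀ (p : Subset n) ps q → zipWith _∪_ (p ∷ ps) (ps ∷ʳ q) ≡ joins (p ∷ ps ∷ʳ q)
joins≡zipWith p []        q = refl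
joins≡zipWith p (p′ ∷ ps) q = cong ((p ∪ p′) ∷_) (joins≡zipWith p′ ps q)

chainLines≡ : ∀ (bs : List (Fin n)) → chainLines bs ≡ linesOf (path true true bs)
chainLines≡ bs = joins≡zipWith ⊥ (map ⁅_⁆ bs) ⊥

loopLines≡ : ∀ (bs : List (Fin n)) → loopLines bs ≡ linesOf (loop bs)
loopLines≡ []       = refl
loopLines≡ (b ∷ bs) = trans (cong (zipWith _∪_ (⁅ b ⁆ ∷ map ⁅_⁆ bs)) (map-++ ⁅_⁆ bs [ b ]))
  (joins≡zipWith ⁅ b ⁆ (map ⁅_⁆ bs) ⁅ b ⁆)

data LoopLength : ℕ → Set where
  l4 : LoopLength 4
  l6 : LoopLength 6
  l8 : ∀ k → LoopLength (8 +ⁿ k)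

loop-length-view : ∀ l → 4 ≤ⁿ l → 2 ℕ.∣ l → LoopLength l
loop-length-view 4 _ _ = l4
loop-length-view 5 _ 2∣ = contradiction 2∣ (from-no (2 ℕ.∣? 5))
loop-length-view 6 _ _ = l6
loop-length-view 7 _ 2∣ = contradiction 2∣ (from-no (2 ℕ.∣? 7))
loop-length-view (suc (suc (suc (suc (suc (suc (suc (suc k)))))))) _ _ = l8 k
loop-length-view 1 (s≤s ()) _
loop-length-view 2 (s≤s (s≤s ())) _
loop-length-view 3 (s≤s (s≤s (s≤s ()))) _

valid-loop : ∀ {bs : List (Fin n)} {l} → length bs ≡ l → LoopLength l → Valid (loop bs)
valid-loop eq l4     = loop4 eq
valid-loop eq l6     = loop6 eq
valid-loop eq (l8 k) = loop8 k eq

valid-chain : ∀ {bs : List (Fin n)} → 4 ≤ⁿ length bs → Valid (path true true bs)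
valid-chain {bs = bs} 4≤ = chain (length bs ∸ 4) (sym (ℕ.m+[n∸m]≡n 4≤))

module _ (G : SimpleLoonyEndgame) where
  open SimpleLoonyEndgame G using (boxes; lines; chains; loops; chain-length; loop-length; disjoint; decompose)

  components : List (Component boxes)
  components = map (path true true) chains ++ map loop loops

  realises-components : Realises lines components
  realises-components = realises (↭-trans decompose (↭-reflexive (sym lines≡))) (subst Unique (sym boxes≡) disjoint)
    where
    lines≡ : concatMap linesOf components ≡ concatMap chainLines chains ++ concatMap loopLines loops
    lines≡ = trans (concatMap-++ linesOf (map (path true true) chains) (map loop loops)) (cong₂ _++_
      (trans (concatMap-map linesOf (path true true) chains) (concatMap-cong (λ bs → sym (chainLines≡ bs)) chains))
      (trans (concatMap-map linesOf loop loops) (concatMap-cong (λ bs → sym (loopLines≡ bs)) loops)))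
    boxes≡ : concatMap boxesOf components ≡ concat chains ++ concat loops
    boxes≡ = trans (concatMap-++ boxesOf (map (path true true) chains) (map loop loops)) (cong₂ _++_
      (trans (concatMap-map boxesOf (path true true) chains) (concatMap-id chains))
      (trans (concatMap-map boxesOf loop loops) (concatMap-id loops)))
      where
      concatMap-id : ∀ (xss : List (List (Fin boxes))) → concatMap (λ xs → xs) xss ≡ concat xss
      concatMap-id xss = cong concat (map-id xss)

  long-chains : No3Chains G → All (λ bs → 4 ≤ⁿ length bs) chains
  long-chains no3 = All.zipWith (λ { (3≤ , ≢3) → ℕ.≤∧≢⇒< 3≤ (≢3 ∘ sym) }) (chain-length , All.map⁻ no3)

  loop-lengths : All (LoopLength ∘ length) loops
  loop-lengths = All.map (λ { {bs} (4≤ , 2∣) → loop-length-view (length bs) 4≤ 2∣ }) loop-length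

  valid-components : No3Chains G → All Valid components
  valid-components no3 = All.++⁺ (All.map⁺ (All.map valid-chain (long-chains no3)))
    (All.map⁺ (All.map (valid-loop refl) loop-lengths))

  total-components : ∀ φ → total φ components ≡ sum (map (φ ∘ path true true) chains) +ⁿ sum (map (φ ∘ loop) loops)
  total-components φ = trans (total-++ φ (map (path true true) chains) (map loop loops))
    (cong₂ (λ x y → sum x +ⁿ sum y) (sym (map-∘ chains)) (sym (map-∘ loops)))

sum-zero : ∀ {A : Set} (xs : List A) → sum (map (λ _ → 0) xs) ≡ 0
sum-zero []       = refl
sum-zero (x ∷ xs) = sum-zero xs

sum-one : ∀ {A : Set} (xs : List A) → sum (map (λ _ → 1) xs) ≡ length xs
sum-one []       = refl
sum-one (x ∷ xs) = cong suc (sum-one xs)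

-- f, m and nb count the loops of length 4, 6 and at least 8; s is the controlled
-- value, without terminal bonus, of the chains and of the loops counted by nb.
module Count (G : SimpleLoonyEndgame) where
  open SimpleLoonyEndgame G using (boxes; lines; chains; loops)

  f m nc nb s : ℕ
  f  = sum (map (is4 ∘ length) loops)
  m  = sum (map (is6 ∘ length) loops)
  nc = length chains
  nb = sum (map (≥8 ∘ length) loops)
  s  = sum (map (λ bs → length bs ∸ 4) chains) +ⁿ sum (map (λ bs → length bs ∸ 8) loops)

  private
    open-none : ∀ φ → (∀ bs → φ (path true true bs) ≡ 0) → (∀ bs → φ (loop bs) ≡ 0) → total φ (components G) ≡ 0
    open-none φ p≡0 l≡0 = trans (total-components G φ) (cong₂ _+ⁿ_
      (trans (cong sum (map-cong p≡0 chains)) (sum-zero chains)) (trans (cong sum (map-cong l≡0 loops)) (sum-zero loops)))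
    only-loops : ∀ φ → (∀ bs → φ (path true true bs) ≡ 0) → total φ (components G) ≡ sum (map (φ ∘ loop) loops)
    only-loops φ p≡0 = trans (total-components G φ) (cong (_+ⁿ sum (map (φ ∘ loop) loops))
      (trans (cong sum (map-cong p≡0 chains)) (sum-zero chains)))

  chains≡ : total Evaluation.chains (components G) ≡ nc
  chains≡ = trans (total-components G Evaluation.chains) (trans (cong₂ _+ⁿ_ (sum-one chains) (sum-zero loops)) (ℕ.+-identityʳ nc))

  v≡ : No3Chains G → v (game G) ≡ + closed f m nc nb s
  v≡ no3 = begin
    v (game G)                                             ≡⟨ value≡eval (fromList lines)
                                                                (subst (λ ls → Realises ls (components G)) (sym (toList∘fromList lines)) (realises-components G))
                                                                (valid-components G no3) ⟩
    score (closedValue (components G)) (total free (components G)) (penaltyOf (components G))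
                                                           ≡⟨ cong₂ (score (closedValue (components G)))
                                                                (open-none free (λ _ → refl) (λ _ → refl))
                                                                (penaltyOf-none (components G) (open-none half (λ _ → refl) (λ _ → refl)) (open-none quad (λ _ → refl) (λ _ → refl))) ⟩
    score (closedValue (components G)) 0 0                 ≡⟨ score-def _ ⟩
    + closedValue (components G)                           ≡⟨ cong +_ closedValue≡ ⟩
    + closed f m nc nb s                                   ∎
    where
    open ≡-Reasoning
    closedValue≡ : closedValue (components G) ≡ closed f m nc nb s
    closedValue≡ rewrite only-loops fours (λ _ → refl) | only-loops sixes (λ _ → refl) | only-loops longs (λ _ → refl)
      | total-components G excess | chains≡ = refl

  no-excess-components : No3Chains G → nc ≡ 0 → nb ≡ 0 → s ≡ 0
  no-excess-components no3 nc≡0 nb≡0 = trans (sym (total-components G excess))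
    (no-excess (valid-components G no3) (trans chains≡ nc≡0) (trans (only-loops longs (λ _ → refl)) nb≡0))

  Empty⊎nonempty : Empty G ⊎ 1 ≤ⁿ f +ⁿ (m +ⁿ (nc +ⁿ nb))
  Empty⊎nonempty = go chains loops (loop-lengths G)
    where
    go : ∀ (cs ls : List (List (Fin boxes))) → All (LoopLength ∘ length) ls →
         (cs ≡ [] × ls ≡ []) ⊎ 1 ≤ⁿ sum (map (is4 ∘ length) ls) +ⁿ (sum (map (is6 ∘ length) ls) +ⁿ (length cs +ⁿ sum (map (≥8 ∘ length) ls)))
    go []       []       []        = inj₁ (refl , refl)
    go (_ ∷ cs) ls       _         = inj₂ (ℕ.≤-trans (ℕ.≤-trans (s≤s z≤n) (ℕ.m≤n+m _ (sum (map (is6 ∘ length) ls)))) (ℕ.m≤n+m _ (sum (map (is4 ∘ length) ls))))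
    go []       (l ∷ ls) (len ∷ _) with length l
    go []       (l ∷ ls) (l4 ∷ _)   | _ = inj₂ (s≤s z≤n)
    go []       (l ∷ ls) (l6 ∷ _)   | _ = inj₂ (ℕ.≤-trans (s≤s z≤n) (ℕ.m≤n+m _ (sum (map (is4 ∘ length) ls))))
    go []       (l ∷ ls) (l8 k ∷ _) | _ = inj₂ (ℕ.≤-trans (ℕ.≤-trans (s≤s z≤n) (ℕ.m≤n+m _ (sum (map (is6 ∘ length) ls)))) (ℕ.m≤n+m _ (sum (map (is4 ∘ length) ls))))

  chains-fcv : All (λ bs → 4 ≤ⁿ length bs) chains →
               sumℤ (map (λ c → + c - + 4) (map length chains)) ≡ + sum (map (λ bs → length bs ∸ 4) chains)
  chains-fcv all = go chains all
    where
    go : ∀ (cs : List (List (Fin boxes))) → All (λ bs → 4 ≤ⁿ length bs) cs →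
         sumℤ (map (λ c → + c - + 4) (map length cs)) ≡ + sum (map (λ bs → length bs ∸ 4) cs)
    go []       []         = refl
    go (c ∷ cs) (4≤ ∷ all) = cong₂ ℤ._+_ (trans (ℤ.m-n≡m⊖n (length c) 4) (ℤ.⊖-≥ 4≤)) (go cs all)

  -- Each 4-loop contributes -4 and each 6-loop -2; collecting these as the subtrahend of `⊖` leaves
  -- a natural number for the long loops and matches the form used by `phase` and `short-exact`.
  loops-fcv : sumℤ (map (λ l → + l - + 8) (map length loops)) ≡
              sum (map (λ bs → length bs ∸ 8) loops) ⊖ (2 *ⁿ m +ⁿ 4 *ⁿ f)
  loops-fcv = go loops (loop-lengths G)
    where
    lemma4 : ∀ m f → 4 +ⁿ (2 *ⁿ m +ⁿ 4 *ⁿ f) ≡ 2 *ⁿ m +ⁿ 4 *ⁿ suc f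
    lemma4 = solve-∀
    lemma6 : ∀ m f → 2 +ⁿ (2 *ⁿ m +ⁿ 4 *ⁿ f) ≡ 2 *ⁿ suc m +ⁿ 4 *ⁿ f
    lemma6 = solve-∀
    go : ∀ (ls : List (List (Fin boxes))) → All (LoopLength ∘ length) ls →
         sumℤ (map (λ l → + l - + 8) (map length ls)) ≡
         sum (map (λ bs → length bs ∸ 8) ls) ⊖ (2 *ⁿ sum (map (is6 ∘ length) ls) +ⁿ 4 *ⁿ sum (map (is4 ∘ length) ls))
    go []       []          = refl
    go (l ∷ ls) (len ∷ all) with length l | go ls all
    go (l ∷ ls) (l4 ∷ all)   | _ | ih = trans (cong (ℤ._+_ (+ 4 - + 8)) ih)
      (trans (ℤ.distribʳ-⊖-+-neg 3 (sum (map (λ bs → length bs ∸ 8) ls)) _)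
        (cong (sum (map (λ bs → length bs ∸ 8) ls) ⊖_) (lemma4 (sum (map (is6 ∘ length) ls)) (sum (map (is4 ∘ length) ls)))))
    go (l ∷ ls) (l6 ∷ all)   | _ | ih = trans (cong (ℤ._+_ (+ 6 - + 8)) ih)
      (trans (ℤ.distribʳ-⊖-+-neg 1 (sum (map (λ bs → length bs ∸ 8) ls)) _)
        (cong (sum (map (λ bs → length bs ∸ 8) ls) ⊖_) (lemma6 (sum (map (is6 ∘ length) ls)) (sum (map (is4 ∘ length) ls)))))
    go (l ∷ ls) (l8 k ∷ all) | _ | ih = trans (cong (ℤ._+_ (+ (8 +ⁿ k) - + 8)) ih)
      (ℤ.distribʳ-⊖-+-pos k (sum (map (λ bs → length bs ∸ 8) ls))
        (2 *ⁿ sum (map (is6 ∘ length) ls) +ⁿ 4 *ⁿ sum (map (is4 ∘ length) ls)))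

  tb≡ : No3Chains G → ¬ Empty G → tb G ≡ + bonus nc
  tb≡ no3 = go chains loops (long-chains G no3)
    where
    go : ∀ (cs ls : List (List (Fin boxes))) → All (λ bs → 4 ≤ⁿ length bs) cs → ¬ (cs ≡ [] × ls ≡ []) →
         terminalBonus (map length cs) (map length ls) ≡ + bonus (length cs)
    go []       []       _        nonempty = contradiction (refl , refl) nonempty
    go []       (_ ∷ _)  _        _ = refl
    go (_ ∷ _)  []       _        _ = refl
    go (c ∷ cs) (_ ∷ _) (4≤ ∷ _) _
      rewrite dec-true (any? (4 ℕ.≤?_) (length c ∷ map length cs)) (here 4≤) = refl

  cv≡ : No3Chains G → ¬ Empty G → cv G ≡ (bonus nc +ⁿ s) ⊖ (2 *ⁿ m +ⁿ 4 *ⁿ f)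
  cv≡ no3 nonempty = begin
    fcv G ℤ.+ tb G                               ≡⟨ cong₂ ℤ._+_ (cong₂ ℤ._+_ (chains-fcv (long-chains G no3)) loops-fcv) (tb≡ no3 nonempty) ⟩
    + sc ℤ.+ (sl ⊖ D) ℤ.+ + bonus nc             ≡⟨ cong (ℤ._+ + bonus nc) (ℤ.distribʳ-⊖-+-pos sc sl D) ⟩
    (sc +ⁿ sl ⊖ D) ℤ.+ + bonus nc                ≡⟨ ℤ.distribˡ-⊖-+-pos (bonus nc) (sc +ⁿ sl) D ⟩
    (sc +ⁿ sl +ⁿ bonus nc) ⊖ D                   ≡⟨ cong (_⊖ D) (ℕ.+-comm (sc +ⁿ sl) (bonus nc)) ⟩
    (bonus nc +ⁿ s) ⊖ D                          ∎
    where
    open ≡-Reasoning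
    sc = sum (map (λ bs → length bs ∸ 4) chains)
    sl = sum (map (λ bs → length bs ∸ 8) loops)
    D  = 2 *ⁿ m +ⁿ 4 *ⁿ f

  #4-loops≡ : #4-loops G ≡ f
  #4-loops≡ = go loops
    where
    go : ∀ (ls : List (List (Fin boxes))) → length (filter (ℕ._≟ 4) (map length ls)) ≡ sum (map (is4 ∘ length) ls)
    go [] = refl
    go (l ∷ ls) with length l
    ... | 0 = go ls
    ... | 1 = go ls
    ... | 2 = go ls
    ... | 3 = go ls
    ... | 4 = cong suc (go ls)
    ... | suc (suc (suc (suc (suc _)))) = go ls

-- A sum over the loops survives the filter whenever its summand vanishes at 4; this covers every
-- loop statistic except the number of 4-loops, which becomes 0.
v-without4Loops : ∀ G → No3Chains G → let open Count G in v (game (without4Loops G)) ≡ + closed 0 m nc nb s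
v-without4Loops G no3 = trans (Count.v≡ (without4Loops G) no3)
  (cong +_ (trans (cong₂ (λ f m → closed f m nc (Count.nb K) (Count.s K)) (kept-none loops) (kept is6 refl loops))
    (cong₂ (closed 0 m nc) (kept ≥8 refl loops) (cong (_+ⁿ_ _) (kept (_∸ 8) refl loops)))))
  where
  open Count G
  open SimpleLoonyEndgame G using (boxes; loops)
  K = without4Loops G
  not4? = λ (bs : List (Fin boxes)) → ¬? (length bs ℕ.≟ 4)
  kept : ∀ (φ : ℕ → ℕ) → φ 4 ≡ 0 → ∀ ls → sum (map (φ ∘ length) (filter not4? ls)) ≡ sum (map (φ ∘ length) ls)
  kept φ φ4≡0 [] = refl
  kept φ φ4≡0 (l ∷ ls) with length l ℕ.≟ 4
  ... | yes l≡4 = begin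
    sum (map (φ ∘ length) (filter not4? (l ∷ ls))) ≡⟨ cong (sum ∘ map (φ ∘ length)) (filter-reject not4? {l} {ls} (λ l≢4 → l≢4 l≡4)) ⟩
    sum (map (φ ∘ length) (filter not4? ls))       ≡⟨ kept φ φ4≡0 ls ⟩
    sum (map (φ ∘ length) ls)                      ≡⟨ cong (_+ⁿ sum (map (φ ∘ length) ls)) (trans (cong φ l≡4) φ4≡0) ⟨
    sum (map (φ ∘ length) (l ∷ ls))                ∎
    where open ≡-Reasoning
  ... | no  l≢4 = trans (cong (sum ∘ map (φ ∘ length)) (filter-accept not4? {l} {ls} l≢4)) (cong (_+ⁿ_ (φ (length l))) (kept φ φ4≡0 ls))
  kept-none : ∀ ls → sum (map (is4 ∘ length) (filter not4? ls)) ≡ 0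
  kept-none [] = refl
  kept-none (l ∷ ls) with length l ℕ.≟ 4
  ... | yes l≡4 = trans (cong (sum ∘ map (is4 ∘ length)) (filter-reject not4? {l} {ls} (λ l≢4 → l≢4 l≡4))) (kept-none ls)
  ... | no  l≢4 = trans (cong (sum ∘ map (is4 ∘ length)) (filter-accept not4? {l} {ls} l≢4)) (cong₂ _+ⁿ_ (is4-≢ (length l) l≢4) (kept-none ls))
    where
    is4-≢ : ∀ x → x ≢ 4 → is4 x ≡ 0
    is4-≢ 0 _ = refl
    is4-≢ 1 _ = refl
    is4-≢ 2 _ = refl
    is4-≢ 3 _ = refl
    is4-≢ 4 x≢ = contradiction refl x≢
    is4-≢ (suc (suc (suc (suc (suc _))))) _ = refl

corollary22 :
    (G : SimpleLoonyEndgame) → No3Chains G →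
    let f = #4-loops G
        c = cv G
        K = without4Loops G
    in
      (c ≥ + 2 ⊎ Empty G → v (game G) ≡ c)
    × (¬ Empty G →
        (c ≤ + 1 → f ≡ 0 → ¬ (+ 2 ∣ c) → v (game G) ≡ + 3)
      × (c ≤ + 1 → f ≡ 0 → + 2 ∣ c →
          (v (game G) ≡ + 2 ⊎ v (game G) ≡ + 4) × v (game G) ≡ c [mod 4 ])
      × (c ≤ + 1 → f ≥ⁿ 1 →
          (d : ℤ) → + 0 ≤ d → d ≤ + 7 → d ≡ v (game K) [mod 8 ] →
            (¬ (2 ℕ.∣ f) → v (game G) ≡ + ∣ + 4 - d ∣)
          × (2 ℕ.∣ f → v (game G) ≡ + 4 - + ∣ + 4 - d ∣)))
corollary22 G no3 = part-a , λ nonempty → part-b nonempty , part-c nonempty , part-d nonempty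
  where
  open Count G
  w = bonus nc +ⁿ s

  2≤bonus : ∀ nc → 2 ≤ⁿ bonus nc
  2≤bonus zero    = ℕ.m≤m+n 2 6
  2≤bonus (suc _) = ℕ.m≤m+n 2 2

  z = no-excess-components no3

  v-start : ¬ Empty G → v (game G) ≡ + short f m w
  v-start nonempty with Empty⊎nonempty
  ... | inj₁ empty = contradiction empty nonempty
  ... | inj₂ 1≤    = trans (v≡ no3) (cong +_ (trans (closed-def f m nc nb s) (short-start f m nc nb s z 1≤)))

  phase-G : f ≡ 0 → ¬ Empty G → ∃ λ x → v (game G) ≡ + x × Phase x (cv G)
  phase-G f≡0 nonempty = fold w open6 m ,
    trans (v-start nonempty) (cong (λ f → + short f m w) f≡0) ,
    subst (Phase _) (sym (trans (cv≡ no3 nonempty) (cong (w ⊖_) (trans (cong (λ f → 2 *ⁿ m +ⁿ 4 *ⁿ f) f≡0) (ℕ.+-identityʳ _)))))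
      (phase w m (ℕ.≤-trans (2≤bonus nc) (ℕ.m≤m+n _ s)))

  empty-case : Empty G → v (game G) ≡ cv G
  empty-case (chains≡[] , loops≡[]) = trans (v≡ no3) empty-value
    where
    empty-value : + closed f m nc nb s ≡ cv G
    empty-value rewrite chains≡[] | loops≡[] = cong +_ (closed-empty 0)

  Empty? : Empty G ⊎ ¬ Empty G
  Empty? with SimpleLoonyEndgame.chains G | SimpleLoonyEndgame.loops G
  ... | []    | []    = inj₁ (refl , refl)
  ... | []    | _ ∷ _ = inj₂ λ { (_ , ()) }
  ... | _ ∷ _ | _     = inj₂ λ { (() , _) }

  part-a : cv G ≥ + 2 ⊎ Empty G → v (game G) ≡ cv G
  part-a (inj₂ empty) = empty-case empty
  part-a (inj₁ c≥2) with Empty?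
  ... | inj₁ empty    = empty-case empty
  ... | inj₂ nonempty = trans (v-start nonempty)
    (trans (short-exact f m w (subst (+ 2 ≤_) (cv≡ no3 nonempty) c≥2)) (sym (cv≡ no3 nonempty)))

  part-b : ¬ Empty G → cv G ≤ + 1 → #4-loops G ≡ 0 → ¬ (+ 2 ∣ cv G) → v (game G) ≡ + 3
  part-b nonempty c≤1 f≡0 ¬2∣ with x , v≡x , p ← phase-G (trans (sym #4-loops≡) f≡0) nonempty =
    trans v≡x (cong +_ (phase-odd p c≤1 ¬2∣))

  part-c : ¬ Empty G → cv G ≤ + 1 → #4-loops G ≡ 0 → + 2 ∣ cv G →
           (v (game G) ≡ + 2 ⊎ v (game G) ≡ + 4) × v (game G) ≡ cv G [mod 4 ]
  part-c nonempty c≤1 f≡0 2∣ with x , v≡x , p ← phase-G (trans (sym #4-loops≡) f≡0) nonempty =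
    subst (λ y → (y ≡ + 2 ⊎ y ≡ + 4) × y ≡ cv G [mod 4 ]) (sym v≡x) (phase-even p c≤1 2∣)

  part-d : ¬ Empty G → cv G ≤ + 1 → #4-loops G ≥ⁿ 1 →
           (d : ℤ) → + 0 ≤ d → d ≤ + 7 → d ≡ v (game (without4Loops G)) [mod 8 ] →
             (¬ (2 ℕ.∣ #4-loops G) → v (game G) ≡ + ∣ + 4 - d ∣)
           × (2 ℕ.∣ #4-loops G → v (game G) ≡ + 4 - + ∣ + 4 - d ∣)
  part-d nonempty c≤1 f≥1 d 0≤d d≤7 d≡ rewrite #4-loops≡ =
    subst (λ y → (¬ (2 ℕ.∣ f) → y ≡ + ∣ + 4 - d ∣) × (2 ℕ.∣ f → y ≡ + 4 - + ∣ + 4 - d ∣))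
      (sym (trans (v≡ no3) (cong +_ (closed-def f m nc nb s))))
      (fold-open4-residue f x≤ d 0≤d d≤7 (subst (λ y → d ≡ y [mod 8 ]) (trans (v-without4Loops G no3) (cong +_ (closed-def 0 m nc nb s))) d≡))
    where
    x≤ : short 0 m (long nc nb s) ≤ⁿ 1 +ⁿ 4 *ⁿ f
    -- Either `K` is non-empty and the phases describe its value, or `G` consists of 4-loops only
    -- and the value of `K` is 0.
    x≤ with m +ⁿ (nc +ⁿ nb) in eq
    ... | suc k = ℕ.≤-trans (ℕ.≤-reflexive (short-start 0 m nc nb s z (subst (1 ≤ⁿ_) (sym eq) (s≤s z≤n))))
      (phase-bound {w} {m} f≥1 (phase w m (ℕ.≤-trans (2≤bonus nc) (ℕ.m≤m+n _ s))) (subst (_≤ + 1) (cv≡ no3 nonempty) c≤1))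
    ... | zero rewrite ℕ.m+n≡0⇒m≡0 m eq | ℕ.m+n≡0⇒m≡0 nc (ℕ.m+n≡0⇒n≡0 m eq) | ℕ.m+n≡0⇒n≡0 nc (ℕ.m+n≡0⇒n≡0 m eq) = z≤n
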